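{- Let $N$ be a finite set partitioned into disjoint sets $A_1,\dots,A_k$, let $\mathcal{F}=\{S\subseteq N : |S\cap A_j|\le 1 \text{ for every } 1\le j\le k\}$ be the independent sets of the corresponding partition matroid, and let $\mathcal{P}=\{x\in[0,1]^N : \sum_{i\in A_j}x_i\le 1 \text{ for every } 1\le j\le k\}$. Then there exists a $\frac{1}{e}$-selectable (randomized) greedy OCRS for $\mathcal{P}$.
   Context: For $x\in\mathcal{P}$, $R(x)\subseteq N$ is the random set of active elements, in which each $i\in N$ appears independently with probability $x_i$. Elements arrive one by one, revealing whether they are active, and an online contention resolution scheme (OCRS) must immediately and irrevocably decide whether to select each active element, keeping the selected set in the feasible family $\mathcal{F}$. A greedy OCRS for $\mathcal{P}$ specifies, for each $x\in\mathcal{P}$, a down-closed family $\mathcal{F}_x\subseteq\mathcal{F}$ before the online process starts, and then selects an arriving active element whenever it, together with the elements already selected, forms a set in $\mathcal{F}_x$. It is randomized if, given $x$, the choice of $\mathcal{F}_x$ is random (drawn independently of $R(x)$). A greedy OCRS is $c$-selectable ($c\in[0,1]$) if for every $x\in\mathcal{P}$ and every $e\in N$, $\Pr[I\cup\{e\}\in\mathcal{F}_x \text{ for all } I\subseteq R(x) \text{ with } I\in\mathcal{F}_x]\ge c$, the probability being over both $R(x)$ and the random choice of $\mathcal{F}_x$. -}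

module Defs where

open import Data.Bool using (Bool; true; false; T; T?; if_then_else_)
import Data.Bool as Bool
open import Data.Fin using (Fin; zero; suc)
open import Data.Fin.Subset using (Subset; inside; outside; ⊥; ⁅_⁆; _∈_; _⊆_; _∩_; _∪_; ∣_∣)
open import Data.Fin.Subset.Properties using (_∈?_; _⊆?_; anySubset?)
open import Data.Integer using (+_)
import Data.Integer as ℤ
import Data.Integer.Properties as ℤ
open import Data.List using (List; []; _∷_; _++_; map; foldr; cartesianProductWith)
open import Data.List.Relation.Unary.All using (All)
open import Data.Nat using (ℕ; zero; suc; _!; _⊔_)
import Data.Nat as ℕ
import Data.Nat.Properties as ℕ
open import Data.Product using (∃; ∃-syntax; _×_; _,_; proj₁; proj₂)
open import Data.Rational using (ℚ; 0ℚ; 1ℚ; ½)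
import Data.Rational as ℚ
import Data.Rational.Properties as ℚ
import Data.Rational.Unnormalised as ℚᵘ
import Data.Rational.Unnormalised.Properties as ℚᵘ
open import Data.Rational.Solver using (module +-*-Solver)
open import Data.Sum using (inj₁; inj₂)
open import Data.Vec using ([]; _∷_)
import Data.Vec.Functional as Vector
open import Function using (_∘_)
open import Level using (0ℓ)
open import Relation.Binary.PropositionalEquality using (_≡_; refl; sym; trans; cong; cong₂; subst; subst₂; _≗_)
open import Relation.Nullary using (Dec; yes; no; does; ¬?; contradiction)
open import Relation.Nullary.Decidable using (map′; decidable-stable; _→-dec_)
open import Relation.Unary using (Pred; Decidable)

------------------------------------------------------------------------
-- Auxiliary facts about ℚ

private

  ∣∣≤ : ∀ {p d} → ℚ.- d ℚ.≤ p → p ℚ.≤ d → ℚ.∣ p ∣ ℚ.≤ d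
  ∣∣≤ {p} {d} lo hi with ℚ.∣p∣≡p∨∣p∣≡-p p
  ... | inj₁ eq = subst (ℚ._≤ d) (sym eq) hi
  ... | inj₂ eq = subst (ℚ._≤ d) (sym eq)
        (subst (ℚ.- p ℚ.≤_) (solve 1 (λ x → :- (:- x) := x) refl d) (ℚ.neg-antimono-≤ lo))
    where open +-*-Solver

  p≤∣p∣ : ∀ p → p ℚ.≤ ℚ.∣ p ∣
  p≤∣p∣ p with ℚ.≤-total 0ℚ p
  ... | inj₁ 0≤p = ℚ.≤-reflexive (sym (ℚ.0≤p⇒∣p∣≡p 0≤p))
  ... | inj₂ p≤0 = ℚ.≤-trans p≤0 (ℚ.0≤∣p∣ p)

  -- Two points of the interval [a , a + d] are at distance at most d.
  close : ∀ {a d x y} → a ℚ.≤ x → x ℚ.≤ a ℚ.+ d → a ℚ.≤ y → y ℚ.≤ a ℚ.+ d →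
          ℚ.∣ x ℚ.- y ∣ ℚ.≤ d
  close {a} {d} {x} {y} a≤x x≤ a≤y y≤ = ∣∣≤
    (subst (ℚ._≤ x ℚ.- y) (solve 2 (λ a d → a :- (a :+ d) := :- d) refl a d)
      (ℚ.+-mono-≤ a≤x (ℚ.neg-antimono-≤ y≤)))
    (subst (x ℚ.- y ℚ.≤_) (solve 2 (λ a d → (a :+ d) :- a := d) refl a d)
      (ℚ.+-mono-≤ x≤ (ℚ.neg-antimono-≤ a≤y)))
    where open +-*-Solver

  halves : ∀ ε → ½ ℚ.* ε ℚ.+ ½ ℚ.* ε ≡ ε
  halves ε = trans (sym (ℚ.*-distribʳ-+ ε ½ ½)) (ℚ.*-identityˡ ε)

  combine : ∀ {ε r} p q → p ℚ.+ q ≡ r → ℚ.∣ p ∣ ℚ.< ½ ℚ.* ε → ℚ.∣ q ∣ ℚ.< ½ ℚ.* ε → ℚ.∣ r ∣ ℚ.< ε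
  combine {ε} p q refl p< q< = ℚ.≤-<-trans (ℚ.∣p+q∣≤∣p∣+∣q∣ p q)
    (subst (ℚ.∣ p ∣ ℚ.+ ℚ.∣ q ∣ ℚ.<_) (halves ε) (ℚ.+-mono-< p< q<))

  *-pos : ∀ {p q} → 0ℚ ℚ.< p → 0ℚ ℚ.< q → 0ℚ ℚ.< p ℚ.* q
  *-pos {p} {q} 0<p 0<q =
    ℚ.positive⁻¹ (p ℚ.* q)
      {{ℚ.pos*pos⇒pos p {{ℚ.positive 0<p}} q {{ℚ.positive 0<q}}}}

  half-pos : ∀ {ε} → 0ℚ ℚ.< ε → 0ℚ ℚ.< ½ ℚ.* ε
  half-pos = *-pos (ℚ.positive⁻¹ ½)

  infix 8 _⁻¹ᵖ[_]
  _⁻¹ᵖ[_] : ∀ p → 0ℚ ℚ.< p → ℚ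
  p ⁻¹ᵖ[ 0<p ] = ℚ.1/_ p {{ℚ.>-nonZero 0<p}}

  ⁻¹ᵖ-pos : ∀ {p} (0<p : 0ℚ ℚ.< p) → 0ℚ ℚ.< p ⁻¹ᵖ[ 0<p ]
  ⁻¹ᵖ-pos {p} 0<p = ℚ.positive⁻¹ _ {{ℚ.1/pos⇒pos p {{ℚ.positive 0<p}}}}

  *-cancel-⁻¹ᵖ : ∀ {p} (0<p : 0ℚ ℚ.< p) ε → p ℚ.* (p ⁻¹ᵖ[ 0<p ] ℚ.* ε) ≡ ε
  *-cancel-⁻¹ᵖ {p} 0<p ε =
    trans (sym (ℚ.*-assoc p (p ⁻¹ᵖ[ 0<p ]) ε))
      (trans (cong (ℚ._* ε) (ℚ.*-inverseʳ p {{ℚ.>-nonZero 0<p}})) (ℚ.*-identityˡ ε))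

  *-mono-≤ : ∀ {p q r s} → 0ℚ ℚ.≤ r → 0ℚ ℚ.≤ q → p ℚ.≤ q → r ℚ.≤ s → p ℚ.* r ℚ.≤ q ℚ.* s
  *-mono-≤ {p} {q} {r} {s} 0≤r 0≤q p≤q r≤s = ℚ.≤-trans
    (ℚ.*-monoʳ-≤-nonNeg r {{ℚ.nonNegative 0≤r}} p≤q)
    (ℚ.*-monoˡ-≤-nonNeg q {{ℚ.nonNegative 0≤q}} r≤s)

------------------------------------------------------------------------
-- Real numbers

IsCauchy : (ℕ → ℚ) → Set
IsCauchy s = ∀ ε → 0ℚ ℚ.< ε →
  ∃[ N ] (∀ m n → N ℕ.≤ m → N ℕ.≤ n → ℚ.∣ s m ℚ.- s n ∣ ℚ.< ε)

-- Cauchy sequences of rationals, identified up to _≃_; the arithmetic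
-- operations act termwise.
record ℝ : Set where
  constructor mkℝ
  field
    seq    : ℕ → ℚ
    cauchy : IsCauchy seq

open ℝ public

infix 4 _≃_ _≤_ _<_

_≃_ : ℝ → ℝ → Set
x ≃ y = ∀ ε → 0ℚ ℚ.< ε → ∃[ N ] (∀ n → N ℕ.≤ n → ℚ.∣ seq x n ℚ.- seq y n ∣ ℚ.< ε)

_≤_ : ℝ → ℝ → Set
x ≤ y = ∀ ε → 0ℚ ℚ.< ε → ∃[ N ] (∀ n → N ℕ.≤ n → seq x n ℚ.≤ seq y n ℚ.+ ε)

_<_ : ℝ → ℝ → Set
x < y = ∃[ δ ] 0ℚ ℚ.< δ × ∃[ N ] (∀ n → N ℕ.≤ n → seq x n ℚ.+ δ ℚ.≤ seq y n)

abstract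
  const-isCauchy : ∀ q → IsCauchy (λ _ → q)
  const-isCauchy q ε 0<ε = 0 , λ _ _ _ _ →
    subst (ℚ._< ε) (cong ℚ.∣_∣ (sym (ℚ.+-inverseʳ q))) 0<ε

fromℚ : ℚ → ℝ
fromℚ q = mkℝ (λ _ → q) (const-isCauchy q)

0ℝ 1ℝ : ℝ
0ℝ = fromℚ 0ℚ
1ℝ = fromℚ 1ℚ

abstract
  +-isCauchy : ∀ x y → IsCauchy (λ n → seq x n ℚ.+ seq y n)
  +-isCauchy x y ε 0<ε =
    let (M , hx) = cauchy x (½ ℚ.* ε) (half-pos 0<ε)
        (N , hy) = cauchy y (½ ℚ.* ε) (half-pos 0<ε)
    in M ⊔ N , λ m n m≥ n≥ →
         combine (seq x m ℚ.- seq x n) (seq y m ℚ.- seq y n)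
           (regroup (seq x m) (seq y m) (seq x n) (seq y n))
           (hx m n (ℕ.m⊔n≤o⇒m≤o M N m≥) (ℕ.m⊔n≤o⇒m≤o M N n≥))
           (hy m n (ℕ.m⊔n≤o⇒n≤o M N m≥) (ℕ.m⊔n≤o⇒n≤o M N n≥))
    where
    open +-*-Solver
    regroup : ∀ a b c d → (a ℚ.- c) ℚ.+ (b ℚ.- d) ≡ (a ℚ.+ b) ℚ.- (c ℚ.+ d)
    regroup = solve 4 (λ a b c d → (a :- c) :+ (b :- d) := (a :+ b) :- (c :+ d)) refl

  neg-isCauchy : ∀ x → IsCauchy (λ n → ℚ.- seq x n)
  neg-isCauchy x ε 0<ε =
    let (N , hx) = cauchy x ε 0<ε
    in N , λ m n m≥ n≥ → subst (ℚ._< ε)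
         (trans (sym (ℚ.∣-p∣≡∣p∣ (seq x m ℚ.- seq x n)))
                (cong ℚ.∣_∣ (ℚ.neg-distrib-+ (seq x m) (ℚ.- seq x n))))
         (hx m n m≥ n≥)

  eventuallyBounded : ∀ x → ∃[ B ] 0ℚ ℚ.< B × ∃[ N ] (∀ n → N ℕ.≤ n → ℚ.∣ seq x n ∣ ℚ.≤ B)
  eventuallyBounded x =
    let (N , hx) = cauchy x 1ℚ (ℚ.positive⁻¹ 1ℚ)
        b = ℚ.∣ seq x N ∣
    in b ℚ.+ 1ℚ , ℚ.+-mono-≤-< (ℚ.0≤∣p∣ (seq x N)) (ℚ.positive⁻¹ 1ℚ) , N , λ n n≥ →
       ℚ.≤-trans
         (subst (ℚ._≤ b ℚ.+ ℚ.∣ seq x n ℚ.- seq x N ∣) (cong ℚ.∣_∣ (telescope (seq x N) (seq x n)))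
           (ℚ.∣p+q∣≤∣p∣+∣q∣ (seq x N) (seq x n ℚ.- seq x N)))
         (ℚ.+-monoʳ-≤ b (ℚ.<⇒≤ (hx n N n≥ ℕ.≤-refl)))
    where
    open +-*-Solver
    telescope : ∀ a b → a ℚ.+ (b ℚ.- a) ≡ b
    telescope = solve 2 (λ a b → a :+ (b :- a) := b) refl

  *-isCauchy : ∀ x y → IsCauchy (λ n → seq x n ℚ.* seq y n)
  *-isCauchy x y ε 0<ε =
    let (B , 0<B , N₁ , hB) = eventuallyBounded x
        (C , 0<C , N₂ , hC) = eventuallyBounded y
        (N₃ , hx) = cauchy x (C ⁻¹ᵖ[ 0<C ] ℚ.* (½ ℚ.* ε)) (*-pos (⁻¹ᵖ-pos 0<C) (half-pos 0<ε))
        (N₄ , hy) = cauchy y (B ⁻¹ᵖ[ 0<B ] ℚ.* (½ ℚ.* ε)) (*-pos (⁻¹ᵖ-pos 0<B) (half-pos 0<ε))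
        ≥₁ = λ {m} (h : (N₁ ⊔ N₂) ⊔ (N₃ ⊔ N₄) ℕ.≤ m) → ℕ.m⊔n≤o⇒m≤o N₁ N₂ (ℕ.m⊔n≤o⇒m≤o (N₁ ⊔ N₂) (N₃ ⊔ N₄) h)
        ≥₂ = λ {m} (h : (N₁ ⊔ N₂) ⊔ (N₃ ⊔ N₄) ℕ.≤ m) → ℕ.m⊔n≤o⇒n≤o N₁ N₂ (ℕ.m⊔n≤o⇒m≤o (N₁ ⊔ N₂) (N₃ ⊔ N₄) h)
        ≥₃ = λ {m} (h : (N₁ ⊔ N₂) ⊔ (N₃ ⊔ N₄) ℕ.≤ m) → ℕ.m⊔n≤o⇒m≤o N₃ N₄ (ℕ.m⊔n≤o⇒n≤o (N₁ ⊔ N₂) (N₃ ⊔ N₄) h)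
        ≥₄ = λ {m} (h : (N₁ ⊔ N₂) ⊔ (N₃ ⊔ N₄) ℕ.≤ m) → ℕ.m⊔n≤o⇒n≤o N₃ N₄ (ℕ.m⊔n≤o⇒n≤o (N₁ ⊔ N₂) (N₃ ⊔ N₄) h)
    in (N₁ ⊔ N₂) ⊔ (N₃ ⊔ N₄) , λ m n m≥ n≥ →
       combine (seq x m ℚ.* (seq y m ℚ.- seq y n)) (seq y n ℚ.* (seq x m ℚ.- seq x n))
         (regroup (seq x m) (seq y m) (seq x n) (seq y n))
         (scaled 0<B {ε} {seq x m} {seq y m ℚ.- seq y n} (hB m (≥₁ m≥)) (hy m n (≥₄ m≥) (≥₄ n≥)))
         (scaled 0<C {ε} {seq y n} {seq x m ℚ.- seq x n} (hC n (≥₂ n≥)) (hx m n (≥₃ m≥) (≥₃ n≥)))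
    where
    open +-*-Solver
    regroup : ∀ a b c d → a ℚ.* (b ℚ.- d) ℚ.+ d ℚ.* (a ℚ.- c) ≡ a ℚ.* b ℚ.- c ℚ.* d
    regroup = solve 4 (λ a b c d → a :* (b :- d) :+ d :* (a :- c) := a :* b :- c :* d) refl

    scaled : ∀ {B} (0<B : 0ℚ ℚ.< B) {ε p q} → ℚ.∣ p ∣ ℚ.≤ B →
             ℚ.∣ q ∣ ℚ.< B ⁻¹ᵖ[ 0<B ] ℚ.* (½ ℚ.* ε) → ℚ.∣ p ℚ.* q ∣ ℚ.< ½ ℚ.* ε
    scaled {B} 0<B {ε} {p} {q} p≤B q< =
      subst₂ ℚ._<_ (sym (ℚ.∣p*q∣≡∣p∣*∣q∣ p q)) (*-cancel-⁻¹ᵖ 0<B (½ ℚ.* ε))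
        (ℚ.≤-<-trans
          (ℚ.*-monoʳ-≤-nonNeg ℚ.∣ q ∣ {{ℚ.nonNegative (ℚ.0≤∣p∣ q)}} p≤B)
          (ℚ.*-monoʳ-<-pos B {{ℚ.positive 0<B}} q<))

infixl 6 _+_ _-_
infixl 7 _*_
infix  8 -_

_+_ _*_ : ℝ → ℝ → ℝ
x + y = mkℝ (λ n → seq x n ℚ.+ seq y n) (+-isCauchy x y)
x * y = mkℝ (λ n → seq x n ℚ.* seq y n) (*-isCauchy x y)

-_ : ℝ → ℝ
- x = mkℝ (λ n → ℚ.- seq x n) (neg-isCauchy x)

_-_ : ℝ → ℝ → ℝ
x - y = x + (- y)

-- The reciprocal of q, with the junk value 0 at q = 0.
recipℚ : ℚ → ℚ
recipℚ q with q ℚ.≟ 0ℚ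
... | yes _  = 0ℚ
... | no q≢0 = ℚ.1/_ q {{ℚ.≢-nonZero q≢0}}

*-recipℚ : ∀ {q} → 0ℚ ℚ.< q → q ℚ.* recipℚ q ≡ 1ℚ
*-recipℚ {q} 0<q with q ℚ.≟ 0ℚ
... | yes q≡0 = contradiction (sym q≡0) (ℚ.<⇒≢ 0<q)
... | no q≢0  = ℚ.*-inverseʳ q {{ℚ.≢-nonZero q≢0}}

abstract
  recip-isCauchy : ∀ x → 0ℝ < x → IsCauchy (λ n → recipℚ (seq x n))
  recip-isCauchy x (δ , 0<δ , N₀ , pos) ε 0<ε =
    let (N , hx) = cauchy x (δ ℚ.* δ ℚ.* ε) (*-pos (*-pos 0<δ 0<δ) 0<ε)
    in N₀ ⊔ N , λ m n m≥ n≥ →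
       ℚ.*-cancelˡ-<-nonNeg (δ ℚ.* δ) {{ℚ.nonNegative (ℚ.<⇒≤ (*-pos 0<δ 0<δ))}}
         (ℚ.≤-<-trans
           (shrink (δ≤ (ℕ.m⊔n≤o⇒m≤o N₀ N m≥)) (δ≤ (ℕ.m⊔n≤o⇒m≤o N₀ N n≥)))
           (hx n m (ℕ.m⊔n≤o⇒n≤o N₀ N n≥) (ℕ.m⊔n≤o⇒n≤o N₀ N m≥)))
    where
    open +-*-Solver

    δ≤ : ∀ {n} → N₀ ℕ.≤ n → δ ℚ.≤ seq x n
    δ≤ n≥ = subst (ℚ._≤ _) (ℚ.+-identityˡ δ) (pos _ n≥)

    -- δ² |1/a − 1/b| ≤ a b |1/a − 1/b| = |b − a|
    shrink : ∀ {a b} → δ ℚ.≤ a → δ ℚ.≤ b →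
             δ ℚ.* δ ℚ.* ℚ.∣ recipℚ a ℚ.- recipℚ b ∣ ℚ.≤ ℚ.∣ b ℚ.- a ∣
    shrink {a} {b} δ≤a δ≤b = ℚ.≤-trans
      (ℚ.*-monoʳ-≤-nonNeg _ {{ℚ.nonNegative (ℚ.0≤∣p∣ (recipℚ a ℚ.- recipℚ b))}}
        (*-mono-≤ (ℚ.<⇒≤ 0<δ) (ℚ.<⇒≤ 0<a) δ≤a δ≤b))
      (ℚ.≤-reflexive (trans
        (cong (ℚ._* ℚ.∣ recipℚ a ℚ.- recipℚ b ∣)
          (sym (ℚ.0≤p⇒∣p∣≡p (ℚ.<⇒≤ (*-pos 0<a 0<b)))))
        (trans (sym (ℚ.∣p*q∣≡∣p∣*∣q∣ (a ℚ.* b) _)) (cong ℚ.∣_∣ clear))))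
      where
      0<a : 0ℚ ℚ.< a
      0<a = ℚ.<-≤-trans 0<δ δ≤a
      0<b : 0ℚ ℚ.< b
      0<b = ℚ.<-≤-trans 0<δ δ≤b
      clear : a ℚ.* b ℚ.* (recipℚ a ℚ.- recipℚ b) ≡ b ℚ.- a
      clear = trans
        (solve 4 (λ a b r s → a :* b :* (r :- s) := b :* (a :* r) :- a :* (b :* s)) refl
          a b (recipℚ a) (recipℚ b))
        (cong₂ ℚ._-_
          (trans (cong (b ℚ.*_) (*-recipℚ 0<a)) (ℚ.*-identityʳ b))
          (trans (cong (a ℚ.*_) (*-recipℚ 0<b)) (ℚ.*-identityʳ a)))

-- The termwise reciprocal of a positive real; the junk value of recipℚ
-- can only occur among finitely many initial terms.
recip : ∀ x → 0ℝ < x → ℝ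
recip x 0<x = mkℝ (λ n → recipℚ (seq x n)) (recip-isCauchy x 0<x)

------------------------------------------------------------------------
-- Euler's number

1/_! : ℕ → ℚ
1/ k ! = ℚ._/_ (+ 1) (k !) {{k ℕ.!≢0}}

-- expSum n = Σ_{k < n} 1/k!
expSum : ℕ → ℚ
expSum zero    = 0ℚ
expSum (suc n) = expSum n ℚ.+ 1/ n !

1/-antimono : ∀ m n .{{_ : ℕ.NonZero m}} .{{_ : ℕ.NonZero n}} → m ℕ.≤ n →
              (+ 1) ℚ./ n ℚ.≤ (+ 1) ℚ./ m
1/-antimono (suc m) (suc n) m≤n = ℚ.toℚᵘ-cancel-≤
  (ℚᵘ.≤-respˡ-≃ (ℚᵘ.≃-sym (ℚ.toℚᵘ-fromℚᵘ (ℚᵘ.mkℚᵘ (+ 1) n)))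
    (ℚᵘ.≤-respʳ-≃ (ℚᵘ.≃-sym (ℚ.toℚᵘ-fromℚᵘ (ℚᵘ.mkℚᵘ (+ 1) m)))
      (ℚᵘ.*≤* (ℤ.*-monoˡ-≤-nonNeg (+ 1) (ℤ.+≤+ m≤n)))))

1/-double : ∀ m .{{_ : ℕ.NonZero m}} .{{_ : ℕ.NonZero (2 ℕ.* m)}} →
            (+ 1) ℚ./ (2 ℕ.* m) ℚ.+ (+ 1) ℚ./ (2 ℕ.* m) ≡ (+ 1) ℚ./ m
1/-double (suc m) = trans
  (cong₂ ℚ._+_ half half)
  (halves ((+ 1) ℚ./ suc m))
  where
  half : (+ 1) ℚ./ (2 ℕ.* suc m) ≡ ½ ℚ.* ((+ 1) ℚ./ suc m)
  half = ℚ.toℚᵘ-injective (ℚᵘ.≃-trans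
    (ℚ.toℚᵘ-fromℚᵘ (ℚᵘ.mkℚᵘ (+ 1) (m ℕ.+ (suc m ℕ.+ 0))))
    (ℚᵘ.≃-sym (ℚᵘ.≃-trans (ℚ.toℚᵘ-homo-* ½ ((+ 1) ℚ./ suc m))
      (ℚᵘ.≃-trans (ℚᵘ.*-congˡ {ℚ.toℚᵘ ½} (ℚ.toℚᵘ-fromℚᵘ (ℚᵘ.mkℚᵘ (+ 1) m)))
        (ℚᵘ.*≡* refl)))))

1/-pos : ∀ m .{{_ : ℕ.NonZero m}} → 0ℚ ℚ.< (+ 1) ℚ./ m
1/-pos m = ℚ.positive⁻¹ _ {{ℚ.normalize-pos 1 m}}

1/!-pos : ∀ n → 0ℚ ℚ.< 1/ n !
1/!-pos n = 1/-pos (n !) {{n ℕ.!≢0}}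

2/!-step : ∀ n → 1 ℕ.≤ n → 1/ suc n ! ℚ.+ 1/ suc n ! ℚ.≤ 1/ n !
2/!-step n 1≤n = ℚ.≤-trans (ℚ.+-mono-≤ le le) (ℚ.≤-reflexive (1/-double (n !)))
  where
  instance
    _ = n ℕ.!≢0
    _ = suc n ℕ.!≢0
    _ = ℕ.m*n≢0 2 (n !)
  le : 1/ suc n ! ℚ.≤ (+ 1) ℚ./ (2 ℕ.* n !)
  le = 1/-antimono (2 ℕ.* n !) (suc n !) (ℕ.*-monoˡ-≤ (n !) (ℕ.s≤s 1≤n))

-- An upper bound for Σ_{k ≥ n} 1/k! when n ≥ 1.
expTail : ℕ → ℚ
expTail n = 1/ n ! ℚ.+ 1/ n !

expSum-mono : ∀ {m n} → m ℕ.≤′ n → expSum m ℚ.≤ expSum n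
expSum-mono ℕ.≤′-refl = ℚ.≤-refl
expSum-mono {n = suc n} (ℕ.≤′-step m≤n) = ℚ.≤-trans (expSum-mono m≤n)
  (subst (ℚ._≤ expSum (suc n)) (ℚ.+-identityʳ (expSum n))
    (ℚ.+-monoʳ-≤ (expSum n) (ℚ.<⇒≤ (1/!-pos n))))

expSum+expTail-antimono : ∀ {m n} → 1 ℕ.≤ m → m ℕ.≤′ n → expSum n ℚ.+ expTail n ℚ.≤ expSum m ℚ.+ expTail m
expSum+expTail-antimono 1≤m ℕ.≤′-refl = ℚ.≤-refl
expSum+expTail-antimono {n = suc n} 1≤m (ℕ.≤′-step m≤n) = ℚ.≤-trans
  (ℚ.≤-trans
    (ℚ.+-monoʳ-≤ (expSum n ℚ.+ 1/ n !) (2/!-step n (ℕ.≤-trans 1≤m (ℕ.≤′⇒≤ m≤n))))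
    (ℚ.≤-reflexive (ℚ.+-assoc (expSum n) (1/ n !) (1/ n !))))
  (expSum+expTail-antimono 1≤m m≤n)

n≤n! : ∀ n → n ℕ.≤ n !
n≤n! zero    = ℕ.z≤n
n≤n! (suc n) = subst (ℕ._≤ suc n !) (ℕ.*-identityʳ (suc n)) (ℕ.*-monoʳ-≤ (suc n) (ℕ.1≤n! n))

archimedean : ∀ ε → 0ℚ ℚ.< ε → ∃[ d ] (+ 1) ℚ./ suc d ℚ.≤ ε
archimedean ε@(ℚ.mkℚ (+ suc p) d _) _ = d , ℚ.toℚᵘ-cancel-≤
  (ℚᵘ.≤-respˡ-≃ (ℚᵘ.≃-sym (ℚ.toℚᵘ-fromℚᵘ (ℚᵘ.mkℚᵘ (+ 1) d)))
    (ℚᵘ.*≤* (ℤ.*-monoʳ-≤-nonNeg (+ suc d) (ℤ.+≤+ (ℕ.s≤s (ℕ.z≤n {p}))))))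
archimedean (ℚ.mkℚ (+ zero) d _) (ℚ.*<* (ℤ.+<+ ()))
archimedean (ℚ.mkℚ (ℤ.-[1+ p ]) d _) (ℚ.*<* ())

expTail-small : ∀ ε → 0ℚ ℚ.< ε → ∃[ N ] 1 ℕ.≤ N × expTail N ℚ.< ε
expTail-small ε 0<ε =
  let (d , le) = archimedean (½ ℚ.* (½ ℚ.* ε)) (half-pos (half-pos 0<ε))
      b = ℚ.≤-trans (1/-antimono (suc d) (suc d !) {{_}} {{suc d ℕ.!≢0}} (n≤n! (suc d))) le
  in suc d , ℕ.s≤s ℕ.z≤n , ℚ.≤-<-trans
       (subst (expTail (suc d) ℚ.≤_) (halves (½ ℚ.* ε)) (ℚ.+-mono-≤ b b))
       (subst₂ ℚ._<_ (ℚ.+-identityʳ _) (halves ε) (ℚ.+-monoʳ-< (½ ℚ.* ε) (half-pos 0<ε)))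

abstract
  expSum-isCauchy : IsCauchy expSum
  expSum-isCauchy ε 0<ε =
    let (N , 1≤N , small) = expTail-small ε 0<ε
        lower = λ {m} (m≥ : N ℕ.≤ m) → expSum-mono (ℕ.≤⇒≤′ m≥)
        upper = λ {m} (m≥ : N ℕ.≤ m) → ℚ.≤-trans
          (subst (ℚ._≤ expSum m ℚ.+ expTail m) (ℚ.+-identityʳ (expSum m))
            (ℚ.+-monoʳ-≤ (expSum m) (ℚ.<⇒≤ (ℚ.+-mono-< (1/!-pos m) (1/!-pos m)))))
          (expSum+expTail-antimono 1≤N (ℕ.≤⇒≤′ m≥))
    in N , λ m n m≥ n≥ → ℚ.≤-<-trans (close (lower m≥) (upper m≥) (lower n≥) (upper n≥)) small

-- e = Σ_{k ≥ 0} 1/k!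
e : ℝ
e = mkℝ expSum expSum-isCauchy

abstract
  0<e : 0ℝ < e
  0<e = 1ℚ , ℚ.positive⁻¹ 1ℚ , 1 , λ n 1≤n → expSum-mono (ℕ.≤⇒≤′ 1≤n)

1/e : ℝ
1/e = recip e 0<e

------------------------------------------------------------------------
-- Finite sums, products and probabilities

∑ ∏ : ∀ {n} → (Fin n → ℝ) → ℝ
∑ = Vector.foldr _+_ 0ℝ
∏ = Vector.foldr _*_ 1ℝ

sumList : List ℝ → ℝ
sumList = foldr _+_ 0ℝ

-- A finitely supported measure, as a list of weighted outcomes; repeated
-- outcomes are allowed and their weights add up.
Weighted : Set → Set
Weighted Ω = List (ℝ × Ω)

IsProbability : ∀ {Ω} → Weighted Ω → Set
IsProbability μ = All (λ (w , _) → 0ℝ ≤ w) μ × sumList (map proj₁ μ) ≃ 1ℝ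

Pr : ∀ {Ω} {P : Pred Ω 0ℓ} → Weighted Ω → Decidable P → ℝ
Pr μ P? = sumList (map (λ (w , ω) → if does (P? ω) then w else 0ℝ) μ)

-- Joint law of two independent random variables.
_⊗_ : ∀ {Ω Ω′} → Weighted Ω → Weighted Ω′ → Weighted (Ω × Ω′)
_⊗_ = cartesianProductWith (λ (v , ω) (w , ω′) → v * w , ω , ω′)

subsets : ∀ n → List (Subset n)
subsets zero    = [] ∷ []
subsets (suc n) = map (inside ∷_) (subsets n) ++ map (outside ∷_) (subsets n)

-- The law of R(x): each element is active independently with probability x i.
activeSet : ∀ {n} → (Fin n → ℝ) → Weighted (Subset n)
activeSet {n} x =
  map (λ S → ∏ (λ i → if does (i ∈? S) then x i else 1ℝ - x i) , S) (subsets n)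

allSubsets? : ∀ {n} {P : Pred (Subset n) 0ℓ} → Decidable P → Dec (∀ S → P S)
allSubsets? P? = map′
  (λ ¬∃ S → decidable-stable (P? S) (λ ¬p → ¬∃ (S , ¬p)))
  (λ ∀p (S , ¬p) → ¬p (∀p S))
  (¬? (anySubset? (¬? ∘ P?)))

------------------------------------------------------------------------
-- Greedy online contention resolution schemes on the ground set Fin n

-- Families of subsets are Bool-valued, so that events about a random
-- family are decidable.  Families are required to contain ⊥: the selected
-- set is initially empty, and for the empty family the event defining
-- selectability would hold vacuously.
record DownClosedFamily {n} (𝓕 : Subset n → Set) : Set where
  field
    member     : Subset n → Bool
    ⊆-feasible : ∀ S → T (member S) → 𝓕 S
    ⊥-member   : T (member ⊥)
    downClosed : ∀ {S S′} → S ⊆ S′ → T (member S′) → T (member S)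

open DownClosedFamily public

SameFamily : ∀ {n} {𝓕 : Subset n → Set} → DownClosedFamily 𝓕 → DownClosedFamily 𝓕 → Set
SameFamily F G = member F ≗ member G

sameFamily? : ∀ {n} {𝓕 : Subset n → Set} (F : DownClosedFamily 𝓕) → Decidable (SameFamily F)
sameFamily? F G = allSubsets? (λ S → member F S Bool.≟ member G S)

-- A greedy scheme selects an arriving active element exactly when the
-- selected set remains in F_x, so the scheme is determined by the law of
-- F_x for every x ∈ 𝒫.  Since F_x ranges over a finite set, its law is
-- finitely supported without loss of generality.  The last field says that
-- this law depends only on the real vector x, not on the Cauchy sequences
-- representing it or on the proof of membership in 𝒫.
record RandomizedGreedyOCRS {n} (𝓕 : Subset n → Set) (𝒫 : (Fin n → ℝ) → Set) : Set where
  field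
    law      : ∀ x → 𝒫 x → Weighted (DownClosedFamily 𝓕)
    law-prob : ∀ x (x∈𝒫 : 𝒫 x) → IsProbability (law x x∈𝒫)
    law-cong : ∀ x y (x∈𝒫 : 𝒫 x) (y∈𝒫 : 𝒫 y) → (∀ i → x i ≃ y i) →
               ∀ (F : DownClosedFamily 𝓕) → Pr (law x x∈𝒫) (sameFamily? F) ≃ Pr (law y y∈𝒫) (sameFamily? F)

open RandomizedGreedyOCRS public

Extends : ∀ {n} {𝓕 : Subset n → Set} → Fin n → Subset n × DownClosedFamily 𝓕 → Set
Extends i (R , F) = ∀ I → I ⊆ R → T (member F I) → T (member F (I ∪ ⁅ i ⁆))

extends? : ∀ {n} {𝓕 : Subset n → Set} (i : Fin n) → Decidable (Extends {𝓕 = 𝓕} i)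
extends? i (R , F) =
  allSubsets? (λ I → (I ⊆? R) →-dec (T? (member F I) →-dec T? (member F (I ∪ ⁅ i ⁆))))

Selectable : ∀ {n} {𝓕 : Subset n → Set} {𝒫 : (Fin n → ℝ) → Set} →
             ℝ → RandomizedGreedyOCRS 𝓕 𝒫 → Set
Selectable c π = ∀ x x∈𝒫 i → c ≤ Pr (activeSet x ⊗ law π x x∈𝒫) (extends? i)

------------------------------------------------------------------------
-- Partition matroids

IsPartition : ∀ {n k} → (Fin k → Subset n) → Set
IsPartition A = (∀ i → ∃[ j ] i ∈ A j) × (∀ {i j j′} → i ∈ A j → i ∈ A j′ → j ≡ j′)

PartitionMatroid : ∀ {n k} → (Fin k → Subset n) → Subset n → Set
PartitionMatroid A S = ∀ j → ∣ S ∩ A j ∣ ℕ.≤ 1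

PartitionPolytope : ∀ {n k} → (Fin k → Subset n) → (Fin n → ℝ) → Set
PartitionPolytope A x =
  (∀ i → 0ℝ ≤ x i × x i ≤ 1ℝ) ×
  (∀ j → ∑ (λ i → if does (i ∈? A j) then x i else 0ℝ) ≤ 1ℝ)

{-# OPTIONS --safe #-}
module Submission where

-- Keep every element i independently with probability p i = 1/(1 + x i), and
-- let F_x consist of the independent sets of kept elements.  Then i can always
-- be added as soon as i is kept and no other element of its part is both active
-- and kept.  Since 1 − x p = p for p = 1/(1 + x), this has probability
-- ∏ 1/(1 + x j) over the part of i, and ∏ (1 + x j) ≤ exp (∑ x j) ≤ e.  With
-- T_N = ∑_{k < N} sᵏ/k! in place of exp, the former inequality comes from
-- (1 + y) T_N(s) ≤ T_{N+1}(s + y), a consequence of Bernoulli's inequality.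

open import Defs
open import Algebra.Bundles using (CommutativeRing)
open import Data.Bool using (Bool; true; false; T; not; _∧_; if_then_else_)
open import Data.Fin using (Fin; zero; suc)
import Data.Fin.Properties as Fin
open import Data.Fin.Subset using (Subset; inside; outside; ⊥; ⁅_⁆; _∈_; _⊆_; _∩_; _∪_; ∣_∣)
open import Data.Fin.Subset.Properties
open import Data.Integer using (+_)
import Data.Integer as ℤ
import Data.Integer.Properties as ℤ
open import Data.List using (List; []; _∷_; _++_; map)
open import Data.List.Properties using (map-∘)
import Data.List.Relation.Unary.All as All
import Data.List.Relation.Unary.All.Properties as All
open import Data.Nat using (ℕ; zero; suc; _⊔_)
import Data.Nat as ℕ
import Data.Nat.Properties as ℕ
open import Data.Product using (∃-syntax; _×_; _,_; proj₁; proj₂)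
open import Data.Rational using (ℚ; 0ℚ; 1ℚ; ½)
import Data.Rational as ℚ
import Data.Rational.Properties as ℚ
open import Data.Rational.Solver using (module +-*-Solver)
import Data.Rational.Unnormalised as ℚᵘ
import Data.Rational.Unnormalised.Properties as ℚᵘ
open import Data.Sum using (_⊎_; inj₁; inj₂)
open import Data.Vec using ([]; _∷_)
open import Function using (_∘_)
open import Level using (0ℓ)
open import Relation.Binary.Bundles using (Preorder)
import Relation.Binary.Reasoning.Preorder
open import Relation.Binary.PropositionalEquality as ≡ using (_≡_; refl; cong; cong₂; subst; subst₂)
open import Relation.Nullary using (Dec; yes; no; does; contradiction)
open import Relation.Nullary.Decidable using (_×-dec_; dec-true; toWitness; fromWitness; isYes)
open +-*-Solver

-- Order and ring structure of ℝ

½*-pos : ∀ {ε} → 0ℚ ℚ.< ε → 0ℚ ℚ.< ½ ℚ.* ε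
½*-pos {ε} 0<ε = ℚ.positive⁻¹ (½ ℚ.* ε) {{ℚ.pos*pos⇒pos ½ ε {{ℚ.positive 0<ε}}}}

½+½ : ∀ ε → ½ ℚ.* ε ℚ.+ ½ ℚ.* ε ≡ ε
½+½ ε = ≡.trans (≡.sym (ℚ.*-distribʳ-+ ε ½ ½)) (ℚ.*-identityˡ ε)

½*-< : ∀ {ε} → 0ℚ ℚ.< ε → ½ ℚ.* ε ℚ.< ε
½*-< {ε} 0<ε = subst₂ ℚ._<_ (ℚ.+-identityʳ _) (½+½ ε) (ℚ.+-monoʳ-< (½ ℚ.* ε) (½*-pos 0<ε))

-- Supplies the tolerance `ε / b` in limit arguments: an error below `δ`, multiplied by a factor
-- bounded by `b`, stays below `ε`.
divide : ∀ {b ε} → 0ℚ ℚ.< b → 0ℚ ℚ.< ε → ∃[ δ ] 0ℚ ℚ.< δ × b ℚ.* δ ≡ ε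
divide {b} {ε} 0<b 0<ε = 1/b ℚ.* ε ,
  ℚ.positive⁻¹ _ {{ℚ.pos*pos⇒pos 1/b {{ℚ.1/pos⇒pos b {{ℚ.positive 0<b}}}} ε {{ℚ.positive 0<ε}}}} ,
  ≡.trans (≡.sym (ℚ.*-assoc b 1/b ε))
    (≡.trans (cong (ℚ._* ε) (ℚ.*-inverseʳ b {{ℚ.>-nonZero 0<b}})) (ℚ.*-identityˡ ε))
  where
  1/b : ℚ
  1/b = ℚ.1/_ b {{ℚ.>-nonZero 0<b}}

p≤∣p∣ : ∀ p → p ℚ.≤ ℚ.∣ p ∣
p≤∣p∣ p with ℚ.≤-total 0ℚ p
... | inj₁ 0≤p = ℚ.≤-reflexive (≡.sym (ℚ.0≤p⇒∣p∣≡p 0≤p))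
... | inj₂ p≤0 = ℚ.≤-trans p≤0 (ℚ.0≤∣p∣ p)

∣p-q∣≤ : ∀ {p q d} → p ℚ.≤ q ℚ.+ d → q ℚ.≤ p ℚ.+ d → ℚ.∣ p ℚ.- q ∣ ℚ.≤ d
∣p-q∣≤ {p} {q} {d} p≤ q≤ with ℚ.∣p∣≡p∨∣p∣≡-p (p ℚ.- q)
... | inj₁ eq = subst₂ ℚ._≤_ (≡.sym eq) (solve 2 (λ q d → q :+ d :- q := d) refl q d)
      (ℚ.+-monoˡ-≤ (ℚ.- q) p≤)
... | inj₂ eq = subst₂ ℚ._≤_
      (≡.trans (solve 2 (λ p q → q :- p := :- (p :- q)) refl p q) (≡.sym eq))
      (solve 2 (λ p d → p :+ d :- p := d) refl p d)
      (ℚ.+-monoˡ-≤ (ℚ.- p) q≤)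

≤+∣p-q∣ : ∀ p q → p ℚ.≤ q ℚ.+ ℚ.∣ p ℚ.- q ∣
≤+∣p-q∣ p q = subst (ℚ._≤ q ℚ.+ ℚ.∣ p ℚ.- q ∣)
  (solve 2 (λ p q → q :+ (p :- q) := p) refl p q)
  (ℚ.+-monoʳ-≤ q (p≤∣p∣ (p ℚ.- q)))

Eventually : (ℕ → Set) → Set
Eventually P = ∃[ N ] (∀ n → N ℕ.≤ n → P n)

always : ∀ {P : ℕ → Set} → (∀ n → P n) → Eventually P
always h = 0 , λ n _ → h n

map-ev : ∀ {P Q : ℕ → Set} → (∀ n → P n → Q n) → Eventually P → Eventually Q
map-ev f (N , h) = N , λ n n≥ → f n (h n n≥)

zip-ev : ∀ {P Q R : ℕ → Set} → (∀ n → P n → Q n → R n) →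
         Eventually P → Eventually Q → Eventually R
zip-ev f (M , g) (N , h) = M ⊔ N , λ n n≥ →
  f n (g n (ℕ.m⊔n≤o⇒m≤o M N n≥)) (h n (ℕ.m⊔n≤o⇒n≤o M N n≥))

infix 4 _≈_ _≲_

-- _≃_ and _≤_ unfold to statements about seq alone, from which Agda cannot
-- infer the two reals; the record types make them inferable.
record _≈_ (x y : ℝ) : Set where
  constructor mk≈
  field un≈ : x ≃ y

record _≲_ (x y : ℝ) : Set where
  constructor mk≲
  field un≲ : x ≤ y

open _≈_ public
open _≲_ public

ev-≤⇒≲ : ∀ {x y} → Eventually (λ n → seq x n ℚ.≤ seq y n) → x ≲ y
ev-≤⇒≲ h = mk≲ λ ε 0<ε → map-ev
  (λ n x≤y → subst (ℚ._≤ _) (ℚ.+-identityʳ _) (ℚ.+-mono-≤ x≤y (ℚ.<⇒≤ 0<ε))) h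

≈⇒≲ : ∀ {x y} → x ≈ y → x ≲ y
≈⇒≲ {x} {y} (mk≈ x≃y) = mk≲ λ ε 0<ε → map-ev
  (λ n d< → ℚ.≤-trans (≤+∣p-q∣ (seq x n) (seq y n)) (ℚ.+-monoʳ-≤ (seq y n) (ℚ.<⇒≤ d<)))
  (x≃y ε 0<ε)

≲-antisym : ∀ {x y} → x ≲ y → y ≲ x → x ≈ y
≲-antisym {x} {y} (mk≲ x≤y) (mk≲ y≤x) = mk≈ λ ε 0<ε → zip-ev
  -- The two inequalities bound the distance only weakly; taking them at half of `ε` leaves room for
  -- the strict bound that `_≃_` asks for.
  (λ n x≤ y≤ → ℚ.≤-<-trans (∣p-q∣≤ x≤ y≤) (½*-< 0<ε))
  (x≤y _ (½*-pos 0<ε)) (y≤x _ (½*-pos 0<ε))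

-- Agreement on a tail suffices, which is what `*-recip` relies on: `recipℚ` may take its junk value
-- at finitely many terms.
ev-≡⇒≈ : ∀ {x y} → Eventually (λ n → seq x n ≡ seq y n) → x ≈ y
ev-≡⇒≈ h = ≲-antisym (ev-≤⇒≲ (map-ev (λ _ → ℚ.≤-reflexive) h))
  (ev-≤⇒≲ (map-ev (λ _ → ℚ.≤-reflexive ∘ ≡.sym) h))

-- The ring operations act termwise, so a polynomial identity between reals reduces to one between
-- rationals, where `solve` applies.
≡⇒≈ : ∀ {x y} → (∀ n → seq x n ≡ seq y n) → x ≈ y
≡⇒≈ h = ev-≡⇒≈ (always h)

≲-trans : ∀ {x y z} → x ≲ y → y ≲ z → x ≲ z
≲-trans {x} {y} {z} (mk≲ x≤y) (mk≲ y≤z) = mk≲ λ ε 0<ε → zip-ev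
  (λ n x≤ y≤ → ℚ.≤-trans x≤ (ℚ.≤-trans (ℚ.+-monoˡ-≤ (½ ℚ.* ε) y≤)
    (ℚ.≤-reflexive (≡.trans (ℚ.+-assoc (seq z n) _ _) (cong (seq z n ℚ.+_) (½+½ ε))))))
  (x≤y _ (½*-pos 0<ε)) (y≤z _ (½*-pos 0<ε))

+-mono-≲ : ∀ {x y u v} → x ≲ y → u ≲ v → x + u ≲ y + v
+-mono-≲ {x} {y} {u} {v} (mk≲ x≤y) (mk≲ u≤v) = mk≲ λ ε 0<ε → zip-ev
  (λ n x≤ u≤ → ℚ.≤-trans (ℚ.+-mono-≤ x≤ u≤) (ℚ.≤-reflexive
    (≡.trans (solve 3 (λ y v d → (y :+ d) :+ (v :+ d) := y :+ v :+ (d :+ d)) refl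
               (seq y n) (seq v n) (½ ℚ.* ε))
             (cong (seq y n ℚ.+ seq v n ℚ.+_) (½+½ ε)))))
  (x≤y _ (½*-pos 0<ε)) (u≤v _ (½*-pos 0<ε))

neg-antimono-≲ : ∀ {x y} → x ≲ y → - y ≲ - x
neg-antimono-≲ {x} {y} (mk≲ x≤y) = mk≲ λ ε 0<ε → map-ev
  (λ n x≤ → subst₂ ℚ._≤_
    (solve 3 (λ x y d → x :+ (:- x :- y) := :- y) refl (seq x n) (seq y n) ε)
    (solve 3 (λ x y d → y :+ d :+ (:- x :- y) := :- x :+ d) refl (seq x n) (seq y n) ε)
    (ℚ.+-monoˡ-≤ (ℚ.- seq x n ℚ.- seq y n) x≤))
  (x≤y ε 0<ε)

-- The terms of `y` are eventually bounded by some `B`, so it suffices that `x` and `x′` are within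
-- `ε / B` of each other.
*-congʳ-≈ : ∀ {x x′} y → x ≈ x′ → x * y ≈ x′ * y
*-congʳ-≈ {x} {x′} y (mk≈ x≃x′) = mk≈ λ ε 0<ε →
  let (B , 0<B , y-bounded) = eventuallyBounded y
      (δ , 0<δ , Bδ≡ε) = divide 0<B 0<ε
  in zip-ev
    (λ n y≤B d<δ → subst₂ ℚ._<_
      (≡.trans (≡.sym (ℚ.∣p*q∣≡∣p∣*∣q∣ (seq y n) (seq x n ℚ.- seq x′ n)))
        (cong ℚ.∣_∣ (solve 3 (λ x x′ y → y :* (x :- x′) := x :* y :- x′ :* y) refl
          (seq x n) (seq x′ n) (seq y n))))
      Bδ≡ε
      (ℚ.≤-<-trans
        (ℚ.*-monoʳ-≤-nonNeg _ {{ℚ.nonNegative (ℚ.0≤∣p∣ (seq x n ℚ.- seq x′ n))}} y≤B)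
        (ℚ.*-monoʳ-<-pos B {{ℚ.positive 0<B}} d<δ)))
    y-bounded (x≃x′ δ 0<δ)

≈-refl : ∀ {x} → x ≈ x
≈-refl = ≡⇒≈ λ _ → refl

≈-sym : ∀ {x y} → x ≈ y → y ≈ x
≈-sym {x} {y} (mk≈ x≃y) = mk≈ λ ε 0<ε → map-ev
  (λ n → subst (ℚ._< ε) (≡.trans (≡.sym (ℚ.∣-p∣≡∣p∣ (seq x n ℚ.- seq y n)))
    (cong ℚ.∣_∣ (solve 2 (λ x y → :- (x :- y) := y :- x) refl (seq x n) (seq y n)))))
  (x≃y ε 0<ε)

≈-trans : ∀ {x y z} → x ≈ y → y ≈ z → x ≈ z
≈-trans x≈y y≈z = ≲-antisym (≲-trans (≈⇒≲ x≈y) (≈⇒≲ y≈z))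
  (≲-trans (≈⇒≲ (≈-sym y≈z)) (≈⇒≲ (≈-sym x≈y)))

+-cong-≈ : ∀ {x y u v} → x ≈ y → u ≈ v → x + u ≈ y + v
+-cong-≈ x≈y u≈v = ≲-antisym (+-mono-≲ (≈⇒≲ x≈y) (≈⇒≲ u≈v))
  (+-mono-≲ (≈⇒≲ (≈-sym x≈y)) (≈⇒≲ (≈-sym u≈v)))

*-comm-≈ : ∀ x y → x * y ≈ y * x
*-comm-≈ x y = ≡⇒≈ λ n → ℚ.*-comm (seq x n) (seq y n)

*-cong-≈ : ∀ {x y u v} → x ≈ y → u ≈ v → x * u ≈ y * v
*-cong-≈ {x} {y} {u} {v} x≈y u≈v = ≈-trans (*-congʳ-≈ u x≈y)
  (≈-trans (*-comm-≈ y u) (≈-trans (*-congʳ-≈ y u≈v) (*-comm-≈ v y)))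

ℝ-commutativeRing : CommutativeRing 0ℓ 0ℓ
ℝ-commutativeRing = record
  { Carrier = ℝ ; _≈_ = _≈_ ; _+_ = _+_ ; _*_ = _*_ ; -_ = -_ ; 0# = 0ℝ ; 1# = 1ℝ
  ; isCommutativeRing = record
    { isRing = record
      { +-isAbelianGroup = record
        { isGroup = record
          { isMonoid = record
            { isSemigroup = record
              { isMagma = record
                { isEquivalence = record { refl = ≈-refl ; sym = ≈-sym ; trans = ≈-trans }
                ; ∙-cong = +-cong-≈
                }
              ; assoc = λ x y z → ≡⇒≈ λ n → ℚ.+-assoc (seq x n) (seq y n) (seq z n)
              }
            ; identity = (λ x → ≡⇒≈ λ n → ℚ.+-identityˡ (seq x n))
                       , (λ x → ≡⇒≈ λ n → ℚ.+-identityʳ (seq x n))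
            }
          ; inverse = (λ x → ≡⇒≈ λ n → ℚ.+-inverseˡ (seq x n))
                    , (λ x → ≡⇒≈ λ n → ℚ.+-inverseʳ (seq x n))
          ; ⁻¹-cong = λ x≈y → ≲-antisym (neg-antimono-≲ (≈⇒≲ (≈-sym x≈y))) (neg-antimono-≲ (≈⇒≲ x≈y))
          }
        ; comm = λ x y → ≡⇒≈ λ n → ℚ.+-comm (seq x n) (seq y n)
        }
      ; *-cong = *-cong-≈
      ; *-assoc = λ x y z → ≡⇒≈ λ n → ℚ.*-assoc (seq x n) (seq y n) (seq z n)
      ; *-identity = (λ x → ≡⇒≈ λ n → ℚ.*-identityˡ (seq x n))
                   , (λ x → ≡⇒≈ λ n → ℚ.*-identityʳ (seq x n))
      ; distrib = (λ x y z → ≡⇒≈ λ n → ℚ.*-distribˡ-+ (seq x n) (seq y n) (seq z n))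
                , (λ x y z → ≡⇒≈ λ n → ℚ.*-distribʳ-+ (seq x n) (seq y n) (seq z n))
      }
    ; *-comm = *-comm-≈
    }
  }

open CommutativeRing ℝ-commutativeRing hiding (Carrier; _≈_; _+_; _*_; -_; _-_; refl; sym; trans; zero)
open import Algebra.Properties.Semiring.Exp semiring using (_^_; ^-congˡ)
open import Algebra.Properties.CommutativeMonoid.Sum +-commutativeMonoid
  using () renaming (sum-cong-≋ to ∑-cong)
open import Algebra.Properties.CommutativeMonoid.Sum *-commutativeMonoid
  using () renaming (sum-cong-≋ to ∏-cong; ∑-distrib-+ to ∏-distrib-*)

≲-preorder : Preorder 0ℓ 0ℓ 0ℓ
≲-preorder = record
  { Carrier = ℝ ; _≈_ = _≈_ ; _≲_ = _≲_
  ; isPreorder = record { isEquivalence = isEquivalence ; reflexive = ≈⇒≲ ; trans = ≲-trans } }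

open Relation.Binary.Reasoning.Preorder ≲-preorder

≲-refl : ∀ {x} → x ≲ x
≲-refl = ≈⇒≲ ≈-refl

-- For 0 ≤ x + δ and 0 ≤ y + δ′ the product x y + δ′ x + δ (y + δ′) is
-- nonnegative, and δ′ and then δ are chosen so that both extra terms are small.
0≲* : ∀ {x y} → 0ℝ ≲ x → 0ℝ ≲ y → 0ℝ ≲ x * y
0≲* {x} {y} (mk≲ 0≤x) (mk≲ 0≤y) = mk≲ λ ε 0<ε →
  let (B , 0<B , x-bounded) = eventuallyBounded x
      (C , 0<C , y-bounded) = eventuallyBounded y
      (δ′ , 0<δ′ , Bδ′≡) = divide 0<B (½*-pos 0<ε)
      0<C+δ′ = ℚ.+-mono-< 0<C 0<δ′
      (δ , 0<δ , Cδ≡) = divide 0<C+δ′ (½*-pos 0<ε)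
  in zip-ev
    (λ n (0≤x+δ , ∣x∣≤B) (0≤y+δ′ , ∣y∣≤C) →
      let a = seq x n
          b = seq y n
          0≤ab = ℚ.≤-trans
            (ℚ.≤-reflexive (≡.sym (ℚ.*-zeroʳ (a ℚ.+ δ))))
            (ℚ.*-monoˡ-≤-nonNeg (a ℚ.+ δ)
              {{ℚ.nonNegative (0≤x+δ)}} 0≤y+δ′)
          aδ′≤ = ℚ.*-monoʳ-≤-nonNeg δ′ {{ℚ.nonNegative (ℚ.<⇒≤ 0<δ′)}}
            (ℚ.≤-trans (p≤∣p∣ a) ∣x∣≤B)
          bδ≤ = ℚ.*-monoʳ-≤-nonNeg δ {{ℚ.nonNegative (ℚ.<⇒≤ 0<δ)}}
            (ℚ.+-monoˡ-≤ δ′ (ℚ.≤-trans (p≤∣p∣ b) ∣y∣≤C))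
      in ℚ.≤-trans 0≤ab (ℚ.≤-trans
        (ℚ.≤-reflexive (solve 4 (λ a b d d′ →
          (a :+ d) :* (b :+ d′) := a :* b :+ (a :* d′ :+ (b :+ d′) :* d)) refl a b δ δ′))
        (ℚ.+-monoʳ-≤ (a ℚ.* b) (ℚ.≤-trans (ℚ.+-mono-≤ aδ′≤ bδ≤)
          (ℚ.≤-reflexive (≡.trans (cong₂ ℚ._+_ Bδ′≡ Cδ≡) (½+½ ε)))))))
    (zip-ev (λ _ → _,_) (0≤x δ 0<δ) x-bounded)
    (zip-ev (λ _ → _,_) (0≤y δ′ 0<δ′) y-bounded)

0≲+ : ∀ {x y} → 0ℝ ≲ x → 0ℝ ≲ y → 0ℝ ≲ x + y
0≲+ 0≲x 0≲y = ≲-trans (≈⇒≲ (≈-sym (+-identityˡ 0ℝ))) (+-mono-≲ 0≲x 0≲y)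

x≲x+y : ∀ {x y} → 0ℝ ≲ y → x ≲ x + y
x≲x+y {x} {y} 0≲y = begin
  x       ≈⟨ +-identityʳ x ⟨
  x + 0ℝ  ∼⟨ +-mono-≲ ≲-refl 0≲y ⟩
  x + y   ∎

≲⇒0≲- : ∀ {x y} → x ≲ y → 0ℝ ≲ y - x
≲⇒0≲- {x} {y} x≲y = begin
  0ℝ     ≈⟨ -‿inverseʳ x ⟨
  x - x  ∼⟨ +-mono-≲ x≲y ≲-refl ⟩
  y - x  ∎

-- The two sides differ by `z * (y - x)`, a product of nonnegative reals.
*-monoˡ-≲ : ∀ {x y z} → 0ℝ ≲ z → x ≲ y → z * x ≲ z * y
*-monoˡ-≲ {x} {y} {z} 0≲z x≲y = begin
  z * x                ∼⟨ x≲x+y (0≲* 0≲z (≲⇒0≲- x≲y)) ⟩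
  z * x + z * (y - x)  ≈⟨ ≡⇒≈ (λ n → solve 3 (λ x y z → z :* x :+ z :* (y :- x) := z :* y) refl
                                        (seq x n) (seq y n) (seq z n)) ⟩
  z * y                ∎

0≲fromℚ : ∀ {q} → 0ℚ ℚ.≤ q → 0ℝ ≲ fromℚ q
0≲fromℚ 0≤q = ev-≤⇒≲ (always λ _ → 0≤q)

0≲1 : 0ℝ ≲ 1ℝ
0≲1 = 0≲fromℚ (ℚ.nonNegative⁻¹ 1ℚ)

0≲∏ : ∀ {n} (f : Fin n → ℝ) → (∀ i → 0ℝ ≲ f i) → 0ℝ ≲ ∏ f
0≲∏ {zero}  f 0≲f = 0≲1
0≲∏ {suc n} f 0≲f = 0≲* (0≲f zero) (0≲∏ (f ∘ suc) (0≲f ∘ suc))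

0≲∑ : ∀ {n} (f : Fin n → ℝ) → (∀ i → 0ℝ ≲ f i) → 0ℝ ≲ ∑ f
0≲∑ {zero}  f 0≲f = ≲-refl
0≲∑ {suc n} f 0≲f = 0≲+ (0≲f zero) (0≲∑ (f ∘ suc) (0≲f ∘ suc))

∏-1 : ∀ {n} (f : Fin n → ℝ) → (∀ i → f i ≈ 1ℝ) → ∏ f ≈ 1ℝ
∏-1 {zero}  f f≈1 = ≈-refl
∏-1 {suc n} f f≈1 = ≈-trans (*-cong (f≈1 zero) (∏-1 (f ∘ suc) (f≈1 ∘ suc))) (*-identityˡ 1ℝ)

-- Reciprocals of positive reals

*-recip : ∀ x (0<x : 0ℝ < x) → x * recip x 0<x ≈ 1ℝ
*-recip x (δ , 0<δ , h) = ev-≡⇒≈ (map-ev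
  (λ n δ≤ → *-recipℚ (ℚ.<-≤-trans 0<δ (subst (ℚ._≤ seq x n) (ℚ.+-identityˡ δ) δ≤))) h)

0≲recip : ∀ x (0<x : 0ℝ < x) → 0ℝ ≲ recip x 0<x
0≲recip x (δ , 0<δ , h) = ev-≤⇒≲ (map-ev
  (λ n δ≤ → 0≤recipℚ (ℚ.<-≤-trans 0<δ (subst (ℚ._≤ seq x n) (ℚ.+-identityˡ δ) δ≤))) h)
  where
  0≤recipℚ : ∀ {q} → 0ℚ ℚ.< q → 0ℚ ℚ.≤ recipℚ q
  0≤recipℚ {q} 0<q = ℚ.*-cancelˡ-≤-pos q {{ℚ.positive 0<q}}
    (subst₂ ℚ._≤_ (≡.sym (ℚ.*-zeroʳ q)) (≡.sym (*-recipℚ 0<q)) (ℚ.nonNegative⁻¹ 1ℚ))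

-- Uniqueness of inverses. The two positivity proofs are arbitrary, so the keeping probabilities
-- depend only on the real vector, as `law-cong` demands.
recip-cong : ∀ {x y} (0<x : 0ℝ < x) (0<y : 0ℝ < y) → x ≈ y → recip x 0<x ≈ recip y 0<y
recip-cong {x} {y} 0<x 0<y x≈y = begin-equality
  r              ≈⟨ *-identityʳ r ⟨
  r * 1ℝ         ≈⟨ *-congˡ (*-recip y 0<y) ⟨
  r * (y * s)    ≈⟨ *-congˡ (*-congʳ x≈y) ⟨
  r * (x * s)    ≈⟨ ≡⇒≈ (λ n → solve 3 (λ r x s → r :* (x :* s) := x :* r :* s) refl
                                 (seq r n) (seq x n) (seq s n)) ⟩
  x * r * s      ≈⟨ *-congʳ (*-recip x 0<x) ⟩
  1ℝ * s         ≈⟨ *-identityˡ s ⟩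
  s              ∎
  where
  r = recip x 0<x
  s = recip y 0<y

-- Truncated exponential series

-- Applied with `m` equal to `N + 1` and `n` equal to `N !`, to relate consecutive coefficients of
-- the exponential series.
1/m*n*m : ∀ m n .{{_ : ℕ.NonZero n}} .{{_ : ℕ.NonZero (m ℕ.* n)}} →
          (+ 1) ℚ./ (m ℕ.* n) ℚ.* ((+ m) ℚ./ 1) ≡ (+ 1) ℚ./ n
1/m*n*m (suc m) (suc n) = ℚ.toℚᵘ-injective (ℚᵘ.≃-trans
  (ℚ.toℚᵘ-homo-* ((+ 1) ℚ./ (suc m ℕ.* suc n)) ((+ suc m) ℚ./ 1))
  (ℚᵘ.≃-trans
    (ℚᵘ.*-cong (ℚ.toℚᵘ-fromℚᵘ (ℚᵘ.mkℚᵘ (+ 1) (n ℕ.+ m ℕ.* suc n))) (ℚ.toℚᵘ-fromℚᵘ (ℚᵘ.mkℚᵘ (+ suc m) 0)))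
    (ℚᵘ.≃-trans (ℚᵘ.*≡* (cong +_ numerators)) (ℚᵘ.≃-sym (ℚ.toℚᵘ-fromℚᵘ (ℚᵘ.mkℚᵘ (+ 1) n))))))
  where
  numerators : (suc m ℕ.+ 0) ℕ.* suc n ≡ suc m ℕ.* suc n ℕ.* 1 ℕ.+ 0
  numerators = ≡.trans (cong (ℕ._* suc n) (ℕ.+-identityʳ (suc m)))
    (≡.sym (≡.trans (ℕ.+-identityʳ _) (ℕ.*-identityʳ _)))

suc/1 : ∀ k → (+ suc k) ℚ./ 1 ≡ 1ℚ ℚ.+ (+ k) ℚ./ 1
suc/1 k = ℚ.toℚᵘ-injective (ℚᵘ.≃-trans (ℚ.toℚᵘ-fromℚᵘ (ℚᵘ.mkℚᵘ (+ suc k) 0))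
  (ℚᵘ.≃-sym (ℚᵘ.≃-trans (ℚ.toℚᵘ-homo-+ 1ℚ ((+ k) ℚ./ 1))
    (ℚᵘ.≃-trans (ℚᵘ.+-congʳ (ℚ.toℚᵘ 1ℚ) (ℚ.toℚᵘ-fromℚᵘ (ℚᵘ.mkℚᵘ (+ k) 0)))
      (ℚᵘ.*≡* (cong (λ m → (+ 1 ℤ.+ m) ℤ.* + 1) (ℤ.*-identityʳ (+ k))))))))

0≲^ : ∀ {x} → 0ℝ ≲ x → ∀ k → 0ℝ ≲ x ^ k
0≲^ 0≲x zero    = 0≲1
0≲^ 0≲x (suc k) = 0≲* 0≲x (0≲^ 0≲x k)

^≲1 : ∀ {x} → 0ℝ ≲ x → x ≲ 1ℝ → ∀ k → x ^ k ≲ 1ℝ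
^≲1 0≲x x≲1 zero = ≲-refl
^≲1 {x} 0≲x x≲1 (suc k) = begin
  x * x ^ k  ∼⟨ *-monoˡ-≲ 0≲x (^≲1 0≲x x≲1 k) ⟩
  x * 1ℝ     ≈⟨ *-identityʳ x ⟩
  x          ∼⟨ x≲1 ⟩
  1ℝ         ∎

fromℕ : ℕ → ℝ
fromℕ k = fromℚ ((+ k) ℚ./ 1)

0≲fromℕ : ∀ k → 0ℝ ≲ fromℕ k
0≲fromℕ k = 0≲fromℚ (ℚ.nonNegative⁻¹ _ {{ℚ.normalize-nonNeg k 1}})

-- The left side is the start of the binomial expansion of the right side. In the induction,
-- multiplying the bound for `k` by `s + y` yields the two terms wanted plus the nonnegative surplus
-- `(k + 1) s^k y²`.
bernoulli : ∀ {s y} → 0ℝ ≲ s → 0ℝ ≲ y → ∀ k →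
            s ^ suc k + fromℕ (suc k) * (s ^ k * y) ≲ (s + y) ^ suc k
bernoulli {s} {y} 0≲s 0≲y zero = ≈⇒≲ (≡⇒≈ λ n →
  solve 2 (λ s y → s :* con 1ℚ :+ con 1ℚ :* (con 1ℚ :* y) := (s :+ y) :* con 1ℚ) refl
    (seq s n) (seq y n))
bernoulli {s} {y} 0≲s 0≲y (suc k) = begin
  s ^ suc (suc k) + fromℕ (suc (suc k)) * (s ^ suc k * y)
    ∼⟨ x≲x+y (0≲* (0≲* (0≲* (0≲fromℕ (suc k)) (0≲^ 0≲s k)) 0≲y) 0≲y) ⟩
  s ^ suc (suc k) + fromℕ (suc (suc k)) * (s ^ suc k * y) + fromℕ (suc k) * s ^ k * y * y
    ≈⟨ (≡⇒≈ λ n → ≡.trans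
         (cong (λ m → seq s n ℚ.* (seq s n ℚ.* seq (s ^ k) n) ℚ.+ m ℚ.* (seq s n ℚ.* seq (s ^ k) n ℚ.* seq y n)
                        ℚ.+ (+ suc k) ℚ./ 1 ℚ.* seq (s ^ k) n ℚ.* seq y n ℚ.* seq y n)
               (suc/1 (suc k)))
         (solve 4 (λ s y p m → s :* (s :* p) :+ (con 1ℚ :+ m) :* (s :* p :* y) :+ m :* p :* y :* y
                            := (s :+ y) :* (s :* p :+ m :* (p :* y))) refl
           (seq s n) (seq y n) (seq (s ^ k) n) ((+ suc k) ℚ./ 1))) ⟩
  (s + y) * (s ^ suc k + fromℕ (suc k) * (s ^ k * y))
    ∼⟨ *-monoˡ-≲ (0≲+ 0≲s 0≲y) (bernoulli 0≲s 0≲y k) ⟩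
  (s + y) * (s + y) ^ suc k ∎

expPoly : ℕ → ℝ → ℝ
expPoly zero    s = 0ℝ
expPoly (suc N) s = expPoly N s + fromℚ (1/ N !) * s ^ N

0≲1/! : ∀ k → 0ℝ ≲ fromℚ (1/ k !)
0≲1/! k = 0≲fromℚ (ℚ.<⇒≤ (1/!-pos k))

-- On the unit interval every power of `s` is at most one, so the sum of the coefficients is an
-- upper bound.
expPoly≲expSum : ∀ N {s} → 0ℝ ≲ s → s ≲ 1ℝ → expPoly N s ≲ fromℚ (expSum N)
expPoly≲expSum zero    0≲s s≲1 = ≲-refl
expPoly≲expSum (suc N) {s} 0≲s s≲1 = begin
  expPoly N s + fromℚ (1/ N !) * s ^ N
    ∼⟨ +-mono-≲ (expPoly≲expSum N 0≲s s≲1) (*-monoˡ-≲ (0≲1/! N) (^≲1 0≲s s≲1 N)) ⟩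
  fromℚ (expSum N) + fromℚ (1/ N !) * 1ℝ
    ≈⟨ ≡⇒≈ (λ _ → cong (expSum N ℚ.+_) (ℚ.*-identityʳ (1/ N !))) ⟩
  fromℚ (expSum (suc N)) ∎

-- The partial sums increase, so all terms of `e` from index `N` on dominate `expSum N`.
expSum≲e : ∀ N → fromℚ (expSum N) ≲ e
expSum≲e N = ev-≤⇒≲ (N , λ n N≤n → expSum-mono (ℕ.≤⇒≤′ N≤n))

-- A tangent line bound: `expPoly N` is the derivative of `expPoly (suc N)`. It is proved degree by
-- degree, adding `bernoulli` scaled by an inverse factorial.
expPoly-+ : ∀ {s y} → 0ℝ ≲ s → 0ℝ ≲ y → ∀ N →
            expPoly (suc N) s + y * expPoly N s ≲ expPoly (suc N) (s + y)
expPoly-+ {s} {y} 0≲s 0≲y zero = ≈⇒≲ (≡⇒≈ λ n →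
  solve 2 (λ a y → a :+ y :* con 0ℚ := a) refl (0ℚ ℚ.+ 1/ 0 ! ℚ.* 1ℚ) (seq y n))
expPoly-+ {s} {y} 0≲s 0≲y (suc N) = begin
  expPoly (suc N) s + fromℚ c′ * s ^ suc N + y * (expPoly N s + fromℚ c * s ^ N)
    -- Writing `c` as `c′ * (N + 1)` gives the two new terms the common factor `c′`, and what
    -- remains is the left side of `bernoulli`.
    ≈⟨ (≡⇒≈ λ n → ≡.trans
         (cong (λ c → seq (expPoly (suc N) s) n ℚ.+ c′ ℚ.* seq (s ^ suc N) n
                        ℚ.+ seq y n ℚ.* (seq (expPoly N s) n ℚ.+ c ℚ.* seq (s ^ N) n))
               (≡.sym (1/m*n*m (suc N) (N ℕ.!) {{N ℕ.!≢0}} {{suc N ℕ.!≢0}})))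
         (solve 7 (λ t t′ c′ m p p′ y → t′ :+ c′ :* p′ :+ y :* (t :+ c′ :* m :* p)
                    := t′ :+ y :* t :+ c′ :* (p′ :+ m :* (p :* y))) refl
           (seq (expPoly N s) n) (seq (expPoly (suc N) s) n) c′ ((+ suc N) ℚ./ 1)
           (seq (s ^ N) n) (seq (s ^ suc N) n) (seq y n))) ⟩
  expPoly (suc N) s + y * expPoly N s + fromℚ c′ * (s ^ suc N + fromℕ (suc N) * (s ^ N * y))
    ∼⟨ +-mono-≲ (expPoly-+ 0≲s 0≲y N) (*-monoˡ-≲ (0≲1/! (suc N)) (bernoulli 0≲s 0≲y N)) ⟩
  expPoly (suc (suc N)) (s + y) ∎
  where
  c c′ : ℚ
  c  = 1/ N !
  c′ = 1/ suc N !

-- Completing `expPoly N s` to `expPoly (suc N) s` adds a nonnegative term, after which `expPoly-+`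
-- applies.
[1+y]expPoly≲ : ∀ {s y} → 0ℝ ≲ s → 0ℝ ≲ y → ∀ N →
                (1ℝ + y) * expPoly N s ≲ expPoly (suc N) (y + s)
[1+y]expPoly≲ {s} {y} 0≲s 0≲y N = begin
  (1ℝ + y) * expPoly N s                          ∼⟨ x≲x+y (0≲* (0≲1/! N) (0≲^ 0≲s N)) ⟩
  (1ℝ + y) * expPoly N s + fromℚ (1/ N !) * s ^ N
    ≈⟨ ≡⇒≈ (λ n → solve 3 (λ y t d → (con 1ℚ :+ y) :* t :+ d := t :+ d :+ y :* t) refl
         (seq y n) (seq (expPoly N s) n) (1/ N ! ℚ.* seq (s ^ N) n)) ⟩
  expPoly (suc N) s + y * expPoly N s             ∼⟨ expPoly-+ 0≲s 0≲y N ⟩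
  expPoly (suc N) (s + y)                         ≈⟨ expPoly-cong (suc N) (+-comm s y) ⟩
  expPoly (suc N) (y + s)                         ∎
  where
  expPoly-cong : ∀ N {s t} → s ≈ t → expPoly N s ≈ expPoly N t
  expPoly-cong zero    s≈t = ≈-refl
  expPoly-cong (suc N) s≈t = +-cong (expPoly-cong N s≈t) (*-congˡ (^-congˡ N s≈t))

-- Each factor raises the truncation index by one. The count starts at `expPoly 1`, the constant
-- one, which matches the empty product.
∏[1+y]≲expPoly : ∀ {m} (y : Fin m → ℝ) → (∀ j → 0ℝ ≲ y j) →
                 ∏ (λ j → 1ℝ + y j) ≲ expPoly (suc m) (∑ y)
∏[1+y]≲expPoly {zero} y 0≲y = ≈⇒≲ (≡⇒≈ λ _ → refl)
∏[1+y]≲expPoly {suc m} y 0≲y = begin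
  (1ℝ + y zero) * ∏ (λ j → 1ℝ + y (suc j))
    ∼⟨ *-monoˡ-≲ (0≲+ 0≲1 (0≲y zero)) (∏[1+y]≲expPoly (y ∘ suc) (0≲y ∘ suc)) ⟩
  (1ℝ + y zero) * expPoly (suc m) (∑ (y ∘ suc))
    ∼⟨ [1+y]expPoly≲ (0≲∑ (y ∘ suc) (0≲y ∘ suc)) (0≲y zero) (suc m) ⟩
  expPoly (suc (suc m)) (∑ y) ∎

∏[1+y]≲e : ∀ {m} (y : Fin m → ℝ) → (∀ j → 0ℝ ≲ y j) → ∑ y ≲ 1ℝ → ∏ (λ j → 1ℝ + y j) ≲ e
∏[1+y]≲e {m} y 0≲y ∑y≲1 = begin
  ∏ (λ j → 1ℝ + y j)      ∼⟨ ∏[1+y]≲expPoly y 0≲y ⟩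
  expPoly (suc m) (∑ y)   ∼⟨ expPoly≲expSum (suc m) (0≲∑ y 0≲y) ∑y≲1 ⟩
  fromℚ (expSum (suc m))  ∼⟨ expSum≲e (suc m) ⟩
  e                       ∎

-- Sums over lists and over all subsets

sumMap : ∀ {Ω : Set} → (Ω → ℝ) → List Ω → ℝ
sumMap f = sumList ∘ map f

sumMap-cong : ∀ {Ω : Set} {f g : Ω → ℝ} → (∀ ω → f ω ≈ g ω) → ∀ ωs → sumMap f ωs ≈ sumMap g ωs
sumMap-cong f≈g []       = ≈-refl
sumMap-cong f≈g (ω ∷ ωs) = +-cong (f≈g ω) (sumMap-cong f≈g ωs)

sumMap-mono : ∀ {Ω : Set} {f g : Ω → ℝ} → (∀ ω → f ω ≲ g ω) → ∀ ωs → sumMap f ωs ≲ sumMap g ωs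
sumMap-mono f≲g []       = ≲-refl
sumMap-mono f≲g (ω ∷ ωs) = +-mono-≲ (f≲g ω) (sumMap-mono f≲g ωs)

sumMap-∘ : ∀ {Ω Ω′ : Set} (f : Ω′ → ℝ) (g : Ω → Ω′) ωs → sumMap f (map g ωs) ≡ sumMap (f ∘ g) ωs
sumMap-∘ f g ωs = cong sumList (≡.sym (map-∘ ωs))

sumMap-++ : ∀ {Ω : Set} (f : Ω → ℝ) ωs ωs′ → sumMap f (ωs ++ ωs′) ≈ sumMap f ωs + sumMap f ωs′
sumMap-++ f []       ωs′ = ≈-sym (+-identityˡ _)
sumMap-++ f (ω ∷ ωs) ωs′ = ≈-trans (+-congˡ (sumMap-++ f ωs ωs′)) (≈-sym (+-assoc (f ω) _ _))

sumMap-*ˡ : ∀ {Ω : Set} (c : ℝ) (f : Ω → ℝ) ωs → sumMap (λ ω → c * f ω) ωs ≈ c * sumMap f ωs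
sumMap-*ˡ c f []       = ≈-sym (zeroʳ c)
sumMap-*ˡ c f (ω ∷ ωs) = ≈-trans (+-congˡ (sumMap-*ˡ c f ωs)) (≈-sym (distribˡ c (f ω) _))

sumMap-⊗ : ∀ {Ω Ω′ : Set} (h : ℝ × Ω × Ω′ → ℝ) (μ : Weighted Ω) (ν : Weighted Ω′) →
           sumMap h (μ ⊗ ν) ≈ sumMap (λ (v , ω) → sumMap (λ (w , ω′) → h (v * w , ω , ω′)) ν) μ
sumMap-⊗ h []            ν = ≈-refl
sumMap-⊗ h ((v , ω) ∷ μ) ν = ≈-trans
  (sumMap-++ h (map (λ (w , ω′) → v * w , ω , ω′) ν) (μ ⊗ ν))
  (+-cong (reflexive (sumMap-∘ h (λ (w , ω′) → v * w , ω , ω′) ν)) (sumMap-⊗ h μ ν))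

-- Expanding the product of binary sums means choosing one summand for every `j`, and the choices
-- correspond to the subsets.
sum-∏ : ∀ {n} (g : Fin n → Bool → ℝ) →
        sumMap (λ S → ∏ λ j → g j (does (j ∈? S))) (subsets n) ≈ ∏ (λ j → g j true + g j false)
sum-∏ {zero}  g = +-identityʳ 1ℝ
sum-∏ {suc n} g = begin-equality
  sumMap G (map (inside ∷_) Ss ++ map (outside ∷_) Ss)
    ≈⟨ sumMap-++ G (map (inside ∷_) Ss) (map (outside ∷_) Ss) ⟩
  sumMap G (map (inside ∷_) Ss) + sumMap G (map (outside ∷_) Ss)
    ≡⟨ cong₂ _+_ (sumMap-∘ G (inside ∷_) Ss) (sumMap-∘ G (outside ∷_) Ss) ⟩
  sumMap (λ S → g zero true * G′ S) Ss + sumMap (λ S → g zero false * G′ S) Ss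
    ≈⟨ +-cong (sumMap-*ˡ _ G′ Ss) (sumMap-*ˡ _ G′ Ss) ⟩
  g zero true * sumMap G′ Ss + g zero false * sumMap G′ Ss
    ≈⟨ distribʳ _ (g zero true) (g zero false) ⟨
  (g zero true + g zero false) * sumMap G′ Ss
    ≈⟨ *-congˡ (sum-∏ (g ∘ suc)) ⟩
  (g zero true + g zero false) * ∏ (λ j → g (suc j) true + g (suc j) false) ∎
  where
  Ss = subsets n
  G : Subset (suc n) → ℝ
  G S = ∏ λ j → g j (does (j ∈? S))
  G′ : Subset n → ℝ
  G′ S = ∏ λ j → g (suc j) (does (j ∈? S))

-- Random subsets with independent memberships

bernoulliWeight : ∀ {n} → (Fin n → ℝ) → Fin n → Bool → ℝ
bernoulliWeight p j b = if b then p j else 1ℝ - p j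

subsetWeight : ∀ {n} → (Fin n → ℝ) → Subset n → ℝ
subsetWeight p S = ∏ λ j → bernoulliWeight p j (does (j ∈? S))

p+[1-p] : ∀ p → p + (1ℝ - p) ≈ 1ℝ
p+[1-p] p = ≡⇒≈ λ n → solve 1 (λ p → p :+ (con 1ℚ :- p) := con 1ℚ) refl (seq p n)

module _ {n} {p : Fin n → ℝ} (0≲p : ∀ j → 0ℝ ≲ p j) (p≲1 : ∀ j → p j ≲ 1ℝ) where

  0≲subsetWeight : ∀ S → 0ℝ ≲ subsetWeight p S
  0≲subsetWeight S = 0≲∏ _ λ j → 0≲bernoulliWeight j (does (j ∈? S))
    where
    0≲bernoulliWeight : ∀ j b → 0ℝ ≲ bernoulliWeight p j b
    0≲bernoulliWeight j true  = 0≲p j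
    0≲bernoulliWeight j false = ≲⇒0≲- (p≲1 j)

  randomSubset-isProbability : ∀ {Ω : Set} (F : Subset n → Ω) →
    IsProbability (map (λ S → subsetWeight p S , F S) (subsets n))
  randomSubset-isProbability F =
    All.map⁺ (All.universal (λ S → un≲ (0≲subsetWeight S)) (subsets n)) ,
    un≈ (begin-equality
      sumList (map proj₁ (map (λ S → subsetWeight p S , F S) (subsets n)))
        ≡⟨ sumMap-∘ proj₁ (λ S → subsetWeight p S , F S) (subsets n) ⟩
      sumMap (subsetWeight p) (subsets n)                    ≈⟨ sum-∏ (bernoulliWeight p) ⟩
      ∏ (λ j → p j + (1ℝ - p j))                             ≈⟨ ∏-1 _ (λ j → p+[1-p] (p j)) ⟩
      1ℝ                                                     ∎)

subsetWeight-cong : ∀ {n} {p q : Fin n → ℝ} → (∀ j → p j ≈ q j) → ∀ S → subsetWeight p S ≈ subsetWeight q S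
subsetWeight-cong {p = p} {q} p≈q S = ∏-cong λ j → weight-cong j (does (j ∈? S))
  where
  weight-cong : ∀ j b → bernoulliWeight p j b ≈ bernoulliWeight q j b
  weight-cong j true  = p≈q j
  weight-cong j false = +-congˡ (-‿cong (p≈q j))

𝟙 : Bool → ℝ
𝟙 b = if b then 1ℝ else 0ℝ

-- A product of indicators is zero or one. The case distinction keeps the pointwise information, so
-- that the event can be derived when the product is one.
∏-𝟙 : ∀ {n} (b : Fin n → Bool) → ((∀ j → T (b j)) × ∏ (𝟙 ∘ b) ≈ 1ℝ) ⊎ ∏ (𝟙 ∘ b) ≈ 0ℝ
∏-𝟙 {zero}  b = inj₁ ((λ ()) , ≈-refl)
∏-𝟙 {suc n} b with b zero in eq | ∏-𝟙 (b ∘ suc)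
... | false | _ = inj₂ (zeroˡ _)
... | true  | inj₁ (all , ≈1) = inj₁
  ( (λ { zero → subst T (≡.sym eq) _ ; (suc j) → all j })
  , ≈-trans (*-identityˡ _) ≈1)
... | true  | inj₂ ≈0 = inj₂ (≈-trans (*-identityˡ _) ≈0)

-- The j-th factor is the probability that ok j holds of the membership of j
-- in the active set R and in the random set K.
∏≲Pr : ∀ {n} {Ω : Set} {x p : Fin n → ℝ} →
  (∀ j → 0ℝ ≲ x j) → (∀ j → x j ≲ 1ℝ) → (∀ j → 0ℝ ≲ p j) → (∀ j → p j ≲ 1ℝ) →
  (F : Subset n → Ω) {P : Subset n × Ω → Set} (P? : ∀ ω → Dec (P ω))
  (ok : Fin n → Bool → Bool → Bool) →
  (∀ R K → (∀ j → T (ok j (does (j ∈? R)) (does (j ∈? K)))) → P (R , F K)) →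
  ∏ (λ j → (x j * (p j * 𝟙 (ok j true true) + (1ℝ - p j) * 𝟙 (ok j true false)))
         + ((1ℝ - x j) * (p j * 𝟙 (ok j false true) + (1ℝ - p j) * 𝟙 (ok j false false))))
  ≲ Pr (activeSet x ⊗ map (λ K → subsetWeight p K , F K) (subsets n)) P?
∏≲Pr {n} {Ω} {x} {p} 0≲x x≲1 0≲p p≲1 F {P} P? ok ok⇒P = begin
  ∏ (λ j → h j true + h j false)
    -- The product is expanded twice, first over the memberships in `R` and then, for fixed `R`,
    -- over those in `K`.
    ≈⟨ sum-∏ h ⟨
  sumMap (λ R → ∏ λ j → h j (does (j ∈? R))) Ss
    ≈⟨ sumMap-cong (λ R → inner R) Ss ⟨
  sumMap (λ R → sumMap (λ K → ∏ λ j → α R j * (β K j * γ R K j)) Ss) Ss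
    -- Each summand is the joint weight of `R` and `K` times the indicator that `ok` holds
    -- everywhere. This condition implies `P`, hence an inequality.
    ∼⟨ sumMap-mono (λ R → sumMap-mono (λ K → pointwise R K) Ss) Ss ⟩
  sumMap (λ R → sumMap (λ K → f (subsetWeight x R * subsetWeight p K , R , F K)) Ss) Ss
    ≈⟨ sumMap-cong (λ R → reflexive (sumMap-∘ (λ (w , ω) → f (subsetWeight x R * w , R , ω)) _ Ss)) Ss ⟨
  sumMap (λ R → sumMap (λ (w , ω) → f (subsetWeight x R * w , R , ω)) ν) Ss
    ≡⟨ sumMap-∘ (λ (v , R) → sumMap (λ (w , ω) → f (v * w , R , ω)) ν) _ Ss ⟨
  sumMap (λ (v , R) → sumMap (λ (w , ω) → f (v * w , R , ω)) ν) (activeSet x)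
    ≈⟨ sumMap-⊗ f (activeSet x) ν ⟨
  Pr (activeSet x ⊗ ν) P? ∎
  where
  Ss = subsets n
  ν = map (λ K → subsetWeight p K , F K) Ss

  f : ℝ × Subset n × Ω → ℝ
  f (w , ω) = if does (P? ω) then w else 0ℝ

  h : Fin n → Bool → ℝ
  h j r = bernoulliWeight x j r * (p j * 𝟙 (ok j r true) + (1ℝ - p j) * 𝟙 (ok j r false))

  α β : Subset n → Fin n → ℝ
  α R j = bernoulliWeight x j (does (j ∈? R))
  β K j = bernoulliWeight p j (does (j ∈? K))

  γ : Subset n → Subset n → Fin n → ℝ
  γ R K j = 𝟙 (ok j (does (j ∈? R)) (does (j ∈? K)))

  inner : ∀ R → sumMap (λ K → ∏ λ j → α R j * (β K j * γ R K j)) Ss ≈ ∏ (λ j → h j (does (j ∈? R)))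
  inner R = ≈-trans
    (sum-∏ λ j k → α R j * (bernoulliWeight p j k * 𝟙 (ok j (does (j ∈? R)) k)))
    (∏-cong λ j → ≈-sym (distribˡ (α R j) _ _))

  0≲weights : ∀ R K → 0ℝ ≲ subsetWeight x R * subsetWeight p K
  0≲weights R K = 0≲* (0≲subsetWeight 0≲x x≲1 R) (0≲subsetWeight 0≲p p≲1 K)

  0≲f : ∀ R K → 0ℝ ≲ f (subsetWeight x R * subsetWeight p K , R , F K)
  0≲f R K with does (P? (R , F K))
  ... | true  = 0≲weights R K
  ... | false = ≲-refl

  factor : ∀ R K → ∏ (λ j → α R j * (β K j * γ R K j)) ≈ subsetWeight x R * subsetWeight p K * ∏ (γ R K)
  factor R K = begin-equality
    ∏ (λ j → α R j * (β K j * γ R K j))        ≈⟨ ∏-distrib-* (α R) (λ j → β K j * γ R K j) ⟩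
    ∏ (α R) * ∏ (λ j → β K j * γ R K j)        ≈⟨ *-congˡ (∏-distrib-* (β K) (γ R K)) ⟩
    ∏ (α R) * (∏ (β K) * ∏ (γ R K))            ≈⟨ *-assoc (∏ (α R)) (∏ (β K)) _ ⟨
    ∏ (α R) * ∏ (β K) * ∏ (γ R K)              ∎

  pointwise : ∀ R K → ∏ (λ j → α R j * (β K j * γ R K j)) ≲ f (subsetWeight x R * subsetWeight p K , R , F K)
  pointwise R K with ∏-𝟙 (λ j → ok j (does (j ∈? R)) (does (j ∈? K)))
  ... | inj₁ (all , ≈1) = ≈⇒≲ (≈-trans (factor R K) (≈-trans (*-congˡ ≈1) (≈-trans (*-identityʳ _)
          (reflexive (cong (if_then w else 0ℝ) (≡.sym (dec-true (P? (R , F K)) (ok⇒P R K all))))))))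
    where w = subsetWeight x R * subsetWeight p K
  ... | inj₂ ≈0 = ≲-trans (≈⇒≲ (≈-trans (factor R K) (≈-trans (*-congˡ ≈0) (zeroʳ _)))) (0≲f R K)

-- The scheme

-- Inversion reverses the order: `y ≲ z` is multiplied by the nonnegative `r * x`. This turns an
-- upper bound `e` on a product into a lower bound `1/e` on its inverse.
recip≲ : ∀ {x y z} (0<z : 0ℝ < z) → 0ℝ ≲ x → x * y ≈ 1ℝ → y ≲ z → recip z 0<z ≲ x
recip≲ {x} {y} {z} 0<z 0≲x xy≈1 y≲z = begin
  r              ≈⟨ *-identityʳ r ⟨
  r * 1ℝ         ≈⟨ *-congˡ xy≈1 ⟨
  r * (x * y)    ∼⟨ *-monoˡ-≲ (0≲recip z 0<z) (*-monoˡ-≲ 0≲x y≲z) ⟩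
  r * (x * z)    ≈⟨ ≡⇒≈ (λ n → solve 3 (λ r x z → r :* (x :* z) := z :* r :* x) refl
                                 (seq r n) (seq x n) (seq z n)) ⟩
  z * r * x      ≈⟨ *-congʳ (*-recip z 0<z) ⟩
  1ℝ * x         ≈⟨ *-identityˡ x ⟩
  x              ∎
  where r = recip z 0<z

0<1+ : ∀ {x} → 0ℝ ≤ x → 0ℝ < 1ℝ + x
-- Terms of a nonnegative real may be slightly negative; at tolerance `½` the terms of `1ℝ + x`
-- still end up at least `½`.
0<1+ {x} 0≤x = ½ , ℚ.positive⁻¹ ½ , map-ev
  (λ n 0≤ → subst (½ ℚ.+ 0ℚ ℚ.≤_)
    (solve 1 (λ a → con ½ :+ (a :+ con ½) := con 1ℚ :+ a) refl (seq x n))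
    (ℚ.+-monoʳ-≤ ½ 0≤))
  (0≤x ½ (ℚ.positive⁻¹ ½))

-- An element that is active with probability x and kept with probability
-- p = 1/(1+x) is as likely to be kept as not to be both active and kept.
1-xp≈p : ∀ {x p} → (1ℝ + x) * p ≈ 1ℝ → 1ℝ - x * p ≈ p
1-xp≈p {x} {p} [1+x]p≈1 = begin-equality
  1ℝ - x * p              ≈⟨ +-congʳ [1+x]p≈1 ⟨
  (1ℝ + x) * p - x * p    ≈⟨ ≡⇒≈ (λ n → solve 2 (λ x p → (con 1ℚ :+ x) :* p :- x :* p := p) refl
                                          (seq x n) (seq p n)) ⟩
  p                       ∎

-- The partition matroid restricted to the kept elements

module _ {n k} (A : Fin k → Subset n) where

  feasible? : ∀ S → Dec (PartitionMatroid A S)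
  feasible? S = Fin.all? λ j → ∣ S ∩ A j ∣ ℕ.≤? 1

  PartitionMatroid-⊆ : ∀ {S S′} → S ⊆ S′ → PartitionMatroid A S′ → PartitionMatroid A S
  PartitionMatroid-⊆ {S} {S′} S⊆S′ feasible j = ℕ.≤-trans
    (p⊆q⇒∣p∣≤∣q∣ λ l∈ → let (l∈S , l∈A) = x∈p∩q⁻ S (A j) l∈ in x∈p∩q⁺ (S⊆S′ l∈S , l∈A))
    (feasible j)

  PartitionMatroid-⊥ : PartitionMatroid A ⊥
  PartitionMatroid-⊥ j = ℕ.≤-trans (p⊆q⇒∣p∣≤∣q∣ (p∩q⊆p ⊥ (A j)))
    (ℕ.≤-trans (ℕ.≤-reflexive (∣⊥∣≡0 n)) ℕ.z≤n)

  isMember : Subset n → Subset n → Bool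
  isMember K S = isYes (S ⊆? K ×-dec feasible? S)

  isMember⁺ : ∀ {K S} → S ⊆ K → PartitionMatroid A S → T (isMember K S)
  isMember⁺ S⊆K feasible = fromWitness ((λ {l} → S⊆K {l}) , feasible)

  isMember⁻ : ∀ {K S} → T (isMember K S) → S ⊆ K × PartitionMatroid A S
  isMember⁻ {K} {S} = toWitness {a? = S ⊆? K ×-dec feasible? S}

  restriction : Subset n → DownClosedFamily (PartitionMatroid A)
  restriction K = record
    { member     = isMember K
    ; ⊆-feasible = λ S S∈ → proj₂ (isMember⁻ {K} S∈)
    ; ⊥-member   = isMember⁺ ⊥⊆ PartitionMatroid-⊥
    ; downClosed = λ S⊆S′ S′∈ → let (S′⊆K , feasible) = isMember⁻ {K} S′∈ in
        isMember⁺ (⊆-trans S⊆S′ S′⊆K) (PartitionMatroid-⊆ S⊆S′ feasible)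
    }

  -- A set `I` inside both `R` and `K` can meet the part of `i` only in `i`, so that part stays
  -- within its bound. By disjointness `i` lies in no other part, and there feasibility is inherited
  -- from `I`.
  extends-restriction : IsPartition A → ∀ {i j R K} → i ∈ A j → i ∈ K →
    (∀ l → l ∈ A j → l ∈ R → l ∈ K → l ≡ i) →
    Extends i (R , restriction K)
  extends-restriction (_ , disjoint) {i} {j} {R} {K} i∈Aj i∈K alone I I⊆R I∈ =
    isMember⁺ I∪i⊆K feasible
    where
    I⊆K×feasible = isMember⁻ {K} I∈
    I⊆K : I ⊆ K
    I⊆K = proj₁ I⊆K×feasible

    I∪i⊆K : I ∪ ⁅ i ⁆ ⊆ K
    I∪i⊆K {l} l∈ with x∈p∪q⁻ I ⁅ i ⁆ l∈
    ... | inj₁ l∈I = I⊆K l∈I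
    ... | inj₂ l∈i = subst (_∈ K) (≡.sym (x∈⁅y⁆⇒x≡y i l∈i)) i∈K

    feasible : PartitionMatroid A (I ∪ ⁅ i ⁆)
    feasible j′ with j′ Fin.≟ j
    ... | yes refl = ℕ.≤-trans (p⊆q⇒∣p∣≤∣q∣ ⊆i) (ℕ.≤-reflexive (∣⁅x⁆∣≡1 i))
      where
      ⊆i : (I ∪ ⁅ i ⁆) ∩ A j ⊆ ⁅ i ⁆
      ⊆i {l} l∈ with x∈p∩q⁻ (I ∪ ⁅ i ⁆) (A j) l∈
      ... | l∈I∪i , l∈A with x∈p∪q⁻ I ⁅ i ⁆ l∈I∪i
      ... | inj₁ l∈I = subst (_∈ ⁅ i ⁆) (≡.sym (alone l l∈A (I⊆R l∈I) (I⊆K l∈I))) (x∈⁅x⁆ i)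
      ... | inj₂ l∈i = l∈i
    ... | no j′≢j = ℕ.≤-trans (p⊆q⇒∣p∣≤∣q∣ ⊆I∩A) (proj₂ I⊆K×feasible j′)
      where
      ⊆I∩A : (I ∪ ⁅ i ⁆) ∩ A j′ ⊆ I ∩ A j′
      ⊆I∩A {l} l∈ with x∈p∩q⁻ (I ∪ ⁅ i ⁆) (A j′) l∈
      ... | l∈I∪i , l∈A with x∈p∪q⁻ I ⁅ i ⁆ l∈I∪i
      ... | inj₁ l∈I = x∈p∩q⁺ (l∈I , l∈A)
      ... | inj₂ l∈i = contradiction
        (disjoint (subst (_∈ A j′) (x∈⁅y⁆⇒x≡y i l∈i) l∈A) i∈Aj) j′≢j

  module _ {x : Fin n → ℝ} (x∈𝒫 : PartitionPolytope A x) where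

    0≲x : ∀ j → 0ℝ ≲ x j
    0≲x j = mk≲ (proj₁ (proj₁ x∈𝒫 j))

    x≲1 : ∀ j → x j ≲ 1ℝ
    x≲1 j = mk≲ (proj₂ (proj₁ x∈𝒫 j))

    keepProb : Fin n → ℝ
    keepProb j = recip (1ℝ + x j) (0<1+ {x j} (un≲ (0≲x j)))

    keepProb-inverse : ∀ j → (1ℝ + x j) * keepProb j ≈ 1ℝ
    keepProb-inverse j = *-recip (1ℝ + x j) _

    0≲keepProb : ∀ j → 0ℝ ≲ keepProb j
    0≲keepProb j = 0≲recip (1ℝ + x j) _

    keepProb≲1 : ∀ j → keepProb j ≲ 1ℝ
    keepProb≲1 j = begin
      keepProb j                   ∼⟨ x≲x+y (0≲* (0≲x j) (0≲keepProb j)) ⟩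
      keepProb j + x j * keepProb j
        ≈⟨ ≡⇒≈ (λ n → solve 2 (λ x p → p :+ x :* p := (con 1ℚ :+ x) :* p) refl
             (seq (x j) n) (seq (keepProb j) n)) ⟩
      (1ℝ + x j) * keepProb j      ≈⟨ keepProb-inverse j ⟩
      1ℝ                           ∎

    restrictionLaw : Weighted (DownClosedFamily (PartitionMatroid A))
    restrictionLaw = map (λ K → subsetWeight keepProb K , restriction K) (subsets n)

  restrictionOCRS : RandomizedGreedyOCRS (PartitionMatroid A) (PartitionPolytope A)
  restrictionOCRS = record
    { law      = λ x x∈𝒫 → restrictionLaw x∈𝒫
    ; law-prob = λ x x∈𝒫 → randomSubset-isProbability (0≲keepProb x∈𝒫) (keepProb≲1 x∈𝒫) restriction
    ; law-cong = λ x y x∈𝒫 y∈𝒫 x≃y F → un≈ (begin-equality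
        Pr (restrictionLaw x∈𝒫) (sameFamily? F)
          ≡⟨ sumMap-∘ (weightOf F) _ (subsets n) ⟩
        sumMap (λ K → weightOf F (subsetWeight (keepProb x∈𝒫) K , restriction K)) (subsets n)
          -- Both laws list the same families in the same order, so only the weights have to be
          -- compared.
          ≈⟨ sumMap-cong (λ K → if-cong (does (sameFamily? F (restriction K)))
               (subsetWeight-cong (λ j → recip-cong _ _ (+-congˡ (mk≈ (x≃y j)))) K)) (subsets n) ⟩
        sumMap (λ K → weightOf F (subsetWeight (keepProb y∈𝒫) K , restriction K)) (subsets n)
          ≡⟨ sumMap-∘ (weightOf F) _ (subsets n) ⟨
        Pr (restrictionLaw y∈𝒫) (sameFamily? F) ∎)
    }
    where
    weightOf : DownClosedFamily (PartitionMatroid A) → ℝ × DownClosedFamily (PartitionMatroid A) → ℝ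
    weightOf F (w , G) = if does (sameFamily? F G) then w else 0ℝ

    if-cong : ∀ b {v w} → v ≈ w → (if b then v else 0ℝ) ≈ (if b then w else 0ℝ)
    if-cong true  v≈w = v≈w
    if-cong false v≈w = ≈-refl

-- The probability that an element can be added

-- The event that `i` can be added is replaced by a condition on each element separately, so that
-- its probability factors. The element `i` itself has to be kept, whether or not it is active.
harmless : (isSelf inPart active kept : Bool) → Bool
harmless true  _     _ k = k
harmless false true  r k = not (r ∧ k)
harmless false false _ _ = true

-- For another element of the part the probability is `1 - x p`, which equals `p` by the choice of
-- `p`; thus `i` and the rest of its part contribute factors of the same form. The implication from
-- `b` to `c` excludes the case of `i` outside its own part.
Pr-harmless : ∀ {x p} → (1ℝ + x) * p ≈ 1ℝ → ∀ b c → (T b → T c) →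
  x * (p * 𝟙 (harmless b c true true) + (1ℝ - p) * 𝟙 (harmless b c true false))
    + (1ℝ - x) * (p * 𝟙 (harmless b c false true) + (1ℝ - p) * 𝟙 (harmless b c false false))
  ≈ (if c then p else 1ℝ)
Pr-harmless {x} {p} _ true true _ = ≡⇒≈ λ n →
  solve 2 (λ x p → x :* (p :* con 1ℚ :+ (con 1ℚ :- p) :* con 0ℚ)
                   :+ (con 1ℚ :- x) :* (p :* con 1ℚ :+ (con 1ℚ :- p) :* con 0ℚ) := p) refl
    (seq x n) (seq p n)
Pr-harmless _ true false self⇒part = contradiction (self⇒part _) λ ()
Pr-harmless {x} {p} [1+x]p≈1 false true _ = ≈-trans
  (≡⇒≈ λ n → solve 2 (λ x p → x :* (p :* con 0ℚ :+ (con 1ℚ :- p) :* con 1ℚ)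
      :+ (con 1ℚ :- x) :* (p :* con 1ℚ :+ (con 1ℚ :- p) :* con 1ℚ) := con 1ℚ :- x :* p) refl
    (seq x n) (seq p n))
  (1-xp≈p [1+x]p≈1)
Pr-harmless {x} {p} _ false false _ = ≡⇒≈ λ n →
  solve 2 (λ x p → x :* (p :* con 1ℚ :+ (con 1ℚ :- p) :* con 1ℚ)
                   :+ (con 1ℚ :- x) :* (p :* con 1ℚ :+ (con 1ℚ :- p) :* con 1ℚ) := con 1ℚ) refl
    (seq x n) (seq p n)

corollary1p2 : (n k : ℕ) (A : Fin k → Subset n) → IsPartition A →
    ∃[ π ] Selectable {𝓕 = PartitionMatroid A} {𝒫 = PartitionPolytope A} 1/e π
corollary1p2 n k A partition = restrictionOCRS A , selectable
  where
  selectable : Selectable 1/e (restrictionOCRS A)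
  selectable x x∈𝒫 i = un≲ (begin
    1/e
      -- Since `y` is `x` on the part of `i` and zero elsewhere, the bound on its sum is the
      -- polytope constraint for `j₀`. The product below is the inverse of `∏ (1 + y j)`, factor by
      -- factor.
      ∼⟨ recip≲ 0<e (0≲∏ _ λ j → 0≲pPart (inPart j) j) p*[1+y]≈1
           (∏[1+y]≲e y (λ j → 0≲yPart (inPart j) j) (mk≲ (proj₂ x∈𝒫 j₀))) ⟩
    ∏ (λ j → if inPart j then p j else 1ℝ)
      ≈⟨ ∏-cong (λ j → Pr-harmless (keepProb-inverse A x∈𝒫 j) (isSelf j) (inPart j) (self⇒inPart j)) ⟨
    ∏ (λ j →
      x j * (p j * 𝟙 (ok j true true) + (1ℝ - p j) * 𝟙 (ok j true false))
      + (1ℝ - x j) * (p j * 𝟙 (ok j false true) + (1ℝ - p j) * 𝟙 (ok j false false)))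
      ∼⟨ ∏≲Pr (0≲x A x∈𝒫) (x≲1 A x∈𝒫) (0≲keepProb A x∈𝒫) (keepProb≲1 A x∈𝒫)
           (restriction A) (extends? i) ok ok⇒extends ⟩
    Pr (activeSet x ⊗ restrictionLaw A x∈𝒫) (extends? i) ∎)
    where
    j₀ = proj₁ (proj₁ partition i)
    i∈A : i ∈ A j₀
    i∈A = proj₂ (proj₁ partition i)

    p : Fin n → ℝ
    p = keepProb A x∈𝒫

    isSelf inPart : Fin n → Bool
    isSelf j = does (j Fin.≟ i)
    inPart j = does (j ∈? A j₀)

    y : Fin n → ℝ
    y j = if inPart j then x j else 0ℝ

    ok : Fin n → Bool → Bool → Bool
    ok j = harmless (isSelf j) (inPart j)

    self⇒inPart : ∀ j → T (isSelf j) → T (inPart j)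
    self⇒inPart j _ with j Fin.≟ i
    ... | yes refl = subst T (≡.sym (dec-true (i ∈? A j₀) i∈A)) _

    -- The test `inPart j` is abstracted to `b`, so that matching on `b` makes the conditional
    -- compute.
    0≲pPart : ∀ b j → 0ℝ ≲ (if b then p j else 1ℝ)
    0≲pPart true  j = 0≲keepProb A x∈𝒫 j
    0≲pPart false j = 0≲1

    0≲yPart : ∀ b j → 0ℝ ≲ (if b then x j else 0ℝ)
    0≲yPart true  j = 0≲x A x∈𝒫 j
    0≲yPart false j = ≲-refl

    partInverse : ∀ b j → (if b then p j else 1ℝ) * (1ℝ + (if b then x j else 0ℝ)) ≈ 1ℝ
    partInverse true  j = ≈-trans (*-comm (p j) (1ℝ + x j)) (keepProb-inverse A x∈𝒫 j)
    partInverse false j = ≡⇒≈ λ _ → refl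

    p*[1+y]≈1 : ∏ (λ j → if inPart j then p j else 1ℝ) * ∏ (λ j → 1ℝ + y j) ≈ 1ℝ
    p*[1+y]≈1 = ≈-trans (≈-sym (∏-distrib-* (λ j → if inPart j then p j else 1ℝ) (λ j → 1ℝ + y j)))
      (∏-1 _ λ j → partInverse (inPart j) j)

    ok⇒extends : ∀ R K → (∀ j → T (ok j (does (j ∈? R)) (does (j ∈? K)))) →
                 Extends i (R , restriction A K)
    ok⇒extends R K allOk = extends-restriction A partition i∈A i∈K alone
      where
      i∈K : i ∈ K
      -- Once `isSelf i` is replaced by `true`, `harmless` returns the membership of `i` in `K`, so
      -- the case of `i` not kept is absurd.
      i∈K with i ∈? K | subst (λ b → T (harmless b (inPart i) (does (i ∈? R)) (does (i ∈? K))))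
                          (dec-true (i Fin.≟ i) refl) (allOk i)
      ... | yes i∈K | _ = i∈K

      alone : ∀ l → l ∈ A j₀ → l ∈ R → l ∈ K → l ≡ i
      alone l l∈A l∈R l∈K with l Fin.≟ i | allOk l
      ... | yes l≡i | _ = l≡i
      -- Another element of the part that is both active and kept makes `harmless` false; the
      -- rewriting exposes this in `h`.
      ... | no l≢i | h rewrite dec-true (l ∈? A j₀) l∈A | dec-true (l ∈? R) l∈R
                             | dec-true (l ∈? K) l∈K = contradiction h λ ()
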